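{- Let $G$ be a Helly graph and $k$ a non-negative integer. (i) $hb(G)\le k$ if and only if $G$ contains no $H_2^{k}$ as an isometric subgraph. (ii) $hb(G)\le k+\frac12$ if and only if $G$ contains neither $H_1^{k+1}$ nor $H_3^{k}$ as an isometric subgraph.
   Context: Graphs are finite, connected, unweighted, undirected and simple; $d$ is the shortest-path distance. A subgraph is isometric if it is induced and distance-preserving; "contains $H$ as an isometric subgraph" means has an isometric subgraph isomorphic to $H$. A graph is Helly if every family of pairwise intersecting disks $D(v,r)=\{u:d(u,v)\le r\}$ has a common vertex. $hb(G)$ is the maximum over quadruples $u,v,w,x$ of one half of the difference between the two largest of $d(u,v)+d(w,x)$, $d(u,w)+d(v,x)$, $d(u,x)+d(v,w)$. King-grid: the graph on $\mathbb{Z}^2$ in which distinct $(x,y),(x',y')$ are adjacent iff $\max(|x-x'|,|y-y'|)=1$; for $u=(x,y)$ let $s(u)=x+y$, $t(u)=x-y$. For an integer $m\ge0$: - $H_1^{m}$ is induced by $\{u: 0\le s(u)\le 2m,\ 0\le t(u)\le 2m\}$; - $H_2^{m}$ is induced by $\{u: 0\le s(u)\le 2m+1,\ -1\le t(u)\le 2m\}\cup\{(-1,0),(2m+1,1)\}$; - $H_3^{m}$ is induced by $\{u: 0\le s(u)\le 2m+2,\ -1\le t(u)\le 2m+1\}\cup\{(m,-m-1),(-1,1),(m+1,m+2),(2m+2,0)\}$. -}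

module Defs where

open import Data.Nat as ℕ using (ℕ; zero; suc; _⊔_; _⊓_; _∸_)
open import Data.Integer as ℤ using (ℤ; +_; -[1+_]; ∣_∣)
open import Data.Fin using (Fin)
open import Data.Bool using (Bool; true)
open import Data.List using (List; allFin; foldr; concatMap; map)
open import Data.Product using (Σ; _×_; _,_; ∃; proj₁)
open import Data.Sum using (_⊎_)
open import Data.Empty using (⊥)
open import Relation.Binary.PropositionalEquality using (_≡_)

record Graph : Set where
  field
    n      : ℕ
    adj    : Fin n → Fin n → Bool
    sym    : ∀ u v → adj u v ≡ adj v u
    irrefl : ∀ u → adj u u ≡ true → ⊥
open Graph public

V : Graph → Set
V G = Fin (n G)

E : (G : Graph) → V G → V G → Set
E G u v = adj G u v ≡ true

data Walk {A : Set} (R : A → A → Set) : A → A → ℕ → Set where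
  here : ∀ {a} → Walk R a a zero
  step : ∀ {a b c k} → R a b → Walk R b c k → Walk R a c (suc k)

IsDist : {A : Set} (R : A → A → Set) → A → A → ℕ → Set
IsDist R u v k = Walk R u v k × (∀ m → Walk R u v m → k ℕ.≤ m)

Connected : Graph → Set
Connected G = ∀ u v → ∃ λ k → Walk (E G) u v k

IsDistFun : (G : Graph) → (V G → V G → ℕ) → Set
IsDistFun G d = ∀ u v → IsDist (E G) u v (d u v)

-- Helly property: every (finite, w.l.o.g. since there are finitely many
-- distinct disks) family of pairwise intersecting disks has a common vertex.

Helly : (G : Graph) → (V G → V G → ℕ) → Set
Helly G d =
  ∀ (m : ℕ) (c : Fin m → V G) (r : Fin m → ℕ) →
  (∀ i j → Σ (V G) λ z → (d (c i) z ℕ.≤ r i) × (d (c j) z ℕ.≤ r j)) →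
  Σ (V G) λ z → ∀ i → d (c i) z ℕ.≤ r i

-- hyperbolicity: hb2 G d = 2 * hb(G)

max3 : ℕ → ℕ → ℕ → ℕ
max3 a b c = a ⊔ b ⊔ c

mid3 : ℕ → ℕ → ℕ → ℕ
mid3 a b c = (a ⊓ b) ⊔ ((a ⊔ b) ⊓ c)

gap : ℕ → ℕ → ℕ → ℕ
gap a b c = max3 a b c ∸ mid3 a b c

quad2 : (G : Graph) → (V G → V G → ℕ) → V G → V G → V G → V G → ℕ
quad2 G d u v w x = gap (d u v ℕ.+ d w x) (d u w ℕ.+ d v x) (d u x ℕ.+ d v w)

maxList : List ℕ → ℕ
maxList = foldr _⊔_ 0

-- twice hb(G): maximum over all quadruples of (largest - second largest)
hb2 : (G : Graph) → (V G → V G → ℕ) → ℕ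
hb2 G d =
  maxList (concatMap (λ u → concatMap (λ v → concatMap (λ w →
    map (λ x → quad2 G d u v w x) (allFin (n G))) (allFin (n G))) (allFin (n G)))
    (allFin (n G)))

Pt : Set
Pt = ℤ × ℤ

King : Pt → Pt → Set
King (x , y) (x' , y') = (∣ x ℤ.- x' ∣ ⊔ ∣ y ℤ.- y' ∣) ≡ 1

s : Pt → ℤ
s (x , y) = x ℤ.+ y

t : Pt → ℤ
t (x , y) = x ℤ.- y

-1ℤ : ℤ
-1ℤ = -[1+ 0 ]

H1 : ℕ → Pt → Set
H1 m u = (+ 0 ℤ.≤ s u) × (s u ℤ.≤ + (2 ℕ.* m)) × (+ 0 ℤ.≤ t u) × (t u ℤ.≤ + (2 ℕ.* m))

H2 : ℕ → Pt → Set
H2 m u =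
  ((+ 0 ℤ.≤ s u) × (s u ℤ.≤ + (2 ℕ.* m ℕ.+ 1)) × (-1ℤ ℤ.≤ t u) × (t u ℤ.≤ + (2 ℕ.* m)))
  ⊎ (u ≡ (-1ℤ , + 0))
  ⊎ (u ≡ (+ (2 ℕ.* m ℕ.+ 1) , + 1))

H3 : ℕ → Pt → Set
H3 m u =
  ((+ 0 ℤ.≤ s u) × (s u ℤ.≤ + (2 ℕ.* m ℕ.+ 2)) × (-1ℤ ℤ.≤ t u) × (t u ℤ.≤ + (2 ℕ.* m ℕ.+ 1)))
  ⊎ (u ≡ (+ m , -[1+ m ]))
  ⊎ (u ≡ (-1ℤ , + 1))
  ⊎ (u ≡ (+ (m ℕ.+ 1) , + (m ℕ.+ 2)))
  ⊎ (u ≡ (+ (2 ℕ.* m ℕ.+ 2) , + 0))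

Sub : (Pt → Set) → Set
Sub P = Σ Pt P

KingSub : (P : Pt → Set) → Sub P → Sub P → Set
KingSub P a b = King (proj₁ a) (proj₁ b)

ContainsIso : (P : Pt → Set) (G : Graph) → (V G → V G → ℕ) → Set
ContainsIso P G d =
  Σ (Sub P → V G) λ f →
    (∀ a b → f a ≡ f b → proj₁ a ≡ proj₁ b)
  × (∀ a b → (KingSub P a b → E G (f a) (f b)) × (E G (f a) (f b) → KingSub P a b))
  × (∀ a b k → IsDist (KingSub P) a b k → d (f a) (f b) ≡ k)

{-# OPTIONS --safe #-}
module Submission where

-- A Helly graph is injective among integer-valued metric spaces: a nonexpansive partial map into it extends one
-- point at a time, since the disks constraining the image of a new point intersect pairwise. In the coordinates
-- (s,t) the king distance is half of the ℓ₁ distance, so each H is a square, with extra points, in which any two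
-- points lie on a common geodesic between two corners. Hence H embeds isometrically as soon as there are vertices
-- a, b, c, e and weights α, β, γ, δ such that the distances among these vertices exceed the distances of the
-- corresponding corners by the sums of the two weights: exactly so for the diagonals ac and be, at most so for the
-- sides, and exactly so for the sides too in the case of H3. Such weights are half integers determined by
-- the six distances once the sides are formally enlarged to make the gap exact, and the parity of
-- d(a,b) + d(a,e) - d(b,e) decides which H has integral weights.

open import Defs hiding (sym)
open import Data.Empty using (⊥; ⊥-elim)
open import Data.Fin using (Fin)
open import Data.Fin.Patterns using (0F; 1F; 2F; 3F)
open import Data.Fin.Properties using (_≟_)
open import Data.Integer as ℤ using (ℤ; +_; -[1+_]; ∣_∣; 0ℤ; 1ℤ; +≤+; -≤-; -≤+)
import Data.Integer.Properties as ℤₚ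
open import Data.Integer.Tactic.RingSolver using (solve; solve-∀)
open import Data.List using (List; []; _∷_; allFin; cartesianProduct; concatMap; length; lookup; map)
open import Data.List.Membership.Propositional using (_∈_; find; lose)
open import Data.List.Membership.Propositional.Properties
  using (∈-allFin; ∈-cartesianProduct⁺; ∈-concatMap⁺; ∈-concatMap⁻; ∈-lookup; ∈-map⁺; ∈-map⁻)
open import Data.List.Relation.Unary.Any using (here; there; index)
open import Data.List.Relation.Unary.Any.Properties using (lookup-index)
open import Data.Nat as ℕ using (ℕ; zero; suc; _≤_; _<_; _+_; _*_; _∸_; _⊔_; _⊓_; z≤n; s≤s)
import Data.Nat.Properties as ℕₚ
import Data.Nat.Tactic.RingSolver as ℕ-Solver
open import Data.Product using (Σ; ∃; ∃₂; _×_; _,_; proj₁; proj₂; swap)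
open import Data.Product.Properties using (≡-dec)
open import Data.Sum using (_⊎_; inj₁; inj₂; [_,_]′)
open import Function.Bundles using (_⇔_; mk⇔)
open import Relation.Binary.Definitions using (tri<; tri≈; tri>)
open import Relation.Binary.PropositionalEquality
open import Relation.Nullary using (¬_; yes; no)

-- Walks and how to cut them.

_++ʷ_ : ∀ {A : Set} {R : A → A → Set} {a b c k l} → Walk R a b k → Walk R b c l → Walk R a c (k + l)
here      ++ʷ v = v
step r w  ++ʷ v = step r (w ++ʷ v)

reverseʷ : ∀ {A : Set} {R : A → A → Set} → (∀ {x y} → R x y → R y x) →
           ∀ {a b k} → Walk R a b k → Walk R b a k
reverseʷ R-sym here = here
reverseʷ {R = R} R-sym (step {k = k} r w) =
  subst (Walk R _ _) (ℕₚ.+-comm k 1) (reverseʷ R-sym w ++ʷ step (R-sym r) here)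

mapʷ : ∀ {A B : Set} {R : A → A → Set} {S : B → B → Set} (f : A → B) →
       (∀ {x y} → R x y → S (f x) (f y)) → ∀ {a b k} → Walk R a b k → Walk S (f a) (f b) k
mapʷ f f-hom here       = here
mapʷ f f-hom (step r w) = step (f-hom r) (mapʷ f f-hom w)

-- The cut is made after `i` steps, or at the end of a walk that is shorter. Applied to a geodesic
-- it yields a common point of two disks around its ends.
splitʷ : ∀ {A : Set} {R : A → A → Set} {a b k} → Walk R a b k → ∀ i j → k ≤ i + j →
         Σ A λ z → (∃ λ i′ → Walk R a z i′ × i′ ≤ i) × (∃ λ j′ → Walk R z b j′ × j′ ≤ j)
splitʷ {a = a} w zero    j k≤j = a , (0 , here , z≤n) , (_ , w , k≤j)
splitʷ here (suc i) j _ = _ , (0 , here , z≤n) , (0 , here , z≤n)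
splitʷ (step r w) (suc i) j (s≤s k≤i+j) with splitʷ w i j k≤i+j
... | z , (i′ , u , i′≤i) , v = z , (suc i′ , step r u , s≤s i′≤i) , v

-- The shortest-path metric and a numerical form of the Helly property.

module ShortestPath (G : Graph) (d : V G → V G → ℕ) (isDist : IsDistFun G d) where

  d≤walk : ∀ {u v k} → Walk (E G) u v k → d u v ≤ k
  d≤walk w = proj₂ (isDist _ _) _ w

  geodesic : ∀ u v → Walk (E G) u v (d u v)
  geodesic u v = proj₁ (isDist u v)

  E-sym : ∀ {u v} → E G u v → E G v u
  E-sym e = trans (Graph.sym G _ _) e

  d-refl : ∀ u → d u u ≡ 0
  d-refl u = ℕₚ.n≤0⇒n≡0 (d≤walk here)

  d-sym≤ : ∀ u v → d u v ≤ d v u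
  d-sym≤ u v = d≤walk (reverseʷ E-sym (geodesic v u))

  d-sym : ∀ u v → d u v ≡ d v u
  d-sym u v = ℕₚ.≤-antisym (d-sym≤ u v) (d-sym≤ v u)

  d-flip : ∀ u v {n} → d u v ≤ n → d v u ≤ n
  d-flip u v = ℕₚ.≤-trans (d-sym≤ v u)

  d-triangle : ∀ u v w → d u w ≤ d u v + d v w
  d-triangle u v w = d≤walk (geodesic u v ++ʷ geodesic v w)

  d≡0⇒≡ : ∀ {u v} → d u v ≡ 0 → u ≡ v
  d≡0⇒≡ {u} {v} eq with d u v | geodesic u v
  d≡0⇒≡ refl | .0 | here = refl

  d≡1⇒E : ∀ {u v} → d u v ≡ 1 → E G u v
  d≡1⇒E {u} {v} eq with d u v | geodesic u v
  d≡1⇒E refl | .1 | step e here = e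

  E⇒d≡1 : ∀ {u v} → E G u v → d u v ≡ 1
  E⇒d≡1 {u} {v} e = ℕₚ.≤-antisym (d≤walk (step e here)) (ℕₚ.n≢0⇒n>0 d≢0)
    where
    d≢0 : d u v ≢ 0
    d≢0 eq with d≡0⇒≡ eq
    ... | refl = irrefl G _ e

  -- Cutting a geodesic between two centres shows that disks meet once their radii sum to at least
  -- the distance. The Helly property thus becomes a condition on numbers, stated for lists because
  -- constraints are added one at a time.
  helly-family : Helly G d → (F : List (V G × ℕ)) →
    (∀ {a b} → a ∈ F → b ∈ F → d (proj₁ a) (proj₁ b) ≤ proj₂ a + proj₂ b) →
    Σ (V G) λ z → ∀ {a} → a ∈ F → d (proj₁ a) z ≤ proj₂ a
  helly-family helly F close = proj₁ common , λ a∈F → subst (λ a → d (proj₁ a) _ ≤ proj₂ a)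
      (sym (lookup-index a∈F)) (proj₂ common (index a∈F))
    where
    meet : ∀ i j → Σ (V G) λ z →
      (d (proj₁ (lookup F i)) z ≤ proj₂ (lookup F i)) × (d (proj₁ (lookup F j)) z ≤ proj₂ (lookup F j))
    meet i j with splitʷ (geodesic _ _) (proj₂ (lookup F i)) (proj₂ (lookup F j))
                    (close (∈-lookup {xs = F} i) (∈-lookup {xs = F} j))
    ... | z , (k , u , k≤) , (l , v , l≤) =
      z , ℕₚ.≤-trans (d≤walk u) k≤ , ℕₚ.≤-trans (d≤walk (reverseʷ E-sym v)) l≤
    common = helly (length F) (λ i → proj₁ (lookup F i)) (λ i → proj₂ (lookup F i)) meet

-- The king metric on the integer grid.

ρ : Pt → Pt → ℕ
ρ (x , y) (x′ , y′) = ∣ x ℤ.- x′ ∣ ⊔ ∣ y ℤ.- y′ ∣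

ρ-refl : ∀ p → ρ p p ≡ 0
ρ-refl (x , y) rewrite ℤₚ.+-inverseʳ x | ℤₚ.+-inverseʳ y = refl

ρ-sym : ∀ p q → ρ p q ≡ ρ q p
ρ-sym (x , y) (x′ , y′) = cong₂ _⊔_ (ℤₚ.∣i-j∣≡∣j-i∣ x x′) (ℤₚ.∣i-j∣≡∣j-i∣ y y′)

∣i-k∣≤∣i-j∣+∣j-k∣ : ∀ i j k → ∣ i ℤ.- k ∣ ≤ ∣ i ℤ.- j ∣ + ∣ j ℤ.- k ∣
∣i-k∣≤∣i-j∣+∣j-k∣ i j k = subst (λ z → ∣ z ∣ ≤ ∣ i ℤ.- j ∣ + ∣ j ℤ.- k ∣)
  (telescope i j k) (ℤₚ.∣i+j∣≤∣i∣+∣j∣ (i ℤ.- j) (j ℤ.- k))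
  where
  telescope : ∀ i j k → (i ℤ.- j) ℤ.+ (j ℤ.- k) ≡ i ℤ.- k
  telescope = solve-∀

∣Δx∣≤ρ : ∀ p q → ∣ proj₁ p ℤ.- proj₁ q ∣ ≤ ρ p q
∣Δx∣≤ρ p q = ℕₚ.m≤m⊔n _ ∣ proj₂ p ℤ.- proj₂ q ∣

∣Δy∣≤ρ : ∀ p q → ∣ proj₂ p ℤ.- proj₂ q ∣ ≤ ρ p q
∣Δy∣≤ρ p q = ℕₚ.m≤n⊔m ∣ proj₁ p ℤ.- proj₁ q ∣ _

ρ-triangle : ∀ p q r → ρ p r ≤ ρ p q + ρ q r
ρ-triangle p q r = ℕₚ.⊔-lub
  (ℕₚ.≤-trans (∣i-k∣≤∣i-j∣+∣j-k∣ (proj₁ p) (proj₁ q) (proj₁ r)) (ℕₚ.+-mono-≤ (∣Δx∣≤ρ p q) (∣Δx∣≤ρ q r)))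
  (ℕₚ.≤-trans (∣i-k∣≤∣i-j∣+∣j-k∣ (proj₂ p) (proj₂ q) (proj₂ r)) (ℕₚ.+-mono-≤ (∣Δy∣≤ρ p q) (∣Δy∣≤ρ q r)))

ρ≡0⇒≡ : ∀ p q → ρ p q ≡ 0 → p ≡ q
ρ≡0⇒≡ p q eq = cong₂ _,_ (zero-gap (∣Δx∣≤ρ p q)) (zero-gap (∣Δy∣≤ρ p q))
  where
  zero-gap : ∀ {i j} → ∣ i ℤ.- j ∣ ≤ ρ p q → i ≡ j
  zero-gap {i} {j} h =
    ℤₚ.i-j≡0⇒i≡j i j (ℤₚ.∣i∣≡0⇒i≡0 (ℕₚ.n≤0⇒n≡0 (ℕₚ.≤-trans h (ℕₚ.≤-reflexive eq))))

ρ≤walk : ∀ {P : Pt → Set} {a b k} → Walk (KingSub P) a b k → ρ (proj₁ a) (proj₁ b) ≤ k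
ρ≤walk {a = a} here = ℕₚ.≤-reflexive (ρ-refl (proj₁ a))
ρ≤walk {a = a} {c} (step {b = b} r w) = ℕₚ.≤-trans (ρ-triangle (proj₁ a) (proj₁ b) (proj₁ c))
  (ℕₚ.+-mono-≤ (ℕₚ.≤-reflexive r) (ρ≤walk w))

King-sym : ∀ {p q} → King p q → King q p
King-sym {p} {q} r = trans (ρ-sym q p) r

-- Extending nonexpansive maps point by point.

module Extension (G : Graph) (d : V G → V G → ℕ) (isDist : IsDistFun G d) (helly : Helly G d) where
  open ShortestPath G d isDist

  -- A disk centred at the first component whose radius depends on the point of the king grid to be placed.
  Constraint : Set
  Constraint = V G × (Pt → ℕ)

  -- `close` is required at every `p`, so that any further point can still be placed; `lipschitz` is
  -- what preserves `close` when a placed point becomes a new constraint.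
  record Consistent (L : List Constraint) : Set where
    field
      close     : ∀ {a b} → a ∈ L → b ∈ L → ∀ p → d (proj₁ a) (proj₁ b) ≤ proj₂ a p + proj₂ b p
      lipschitz : ∀ {a} → a ∈ L → ∀ p q → proj₂ a q ≤ proj₂ a p + ρ p q
  open Consistent

  -- The disks with radii taken at `p` meet pairwise by `close`. Passing from `q` to `p` raises an
  -- old radius by at most `ρ p q`, which is exactly the radius at `q` of the new constraint.
  place : ∀ {L} → Consistent L → ∀ p →
    Σ (V G) λ z → (∀ {a} → a ∈ L → d (proj₁ a) z ≤ proj₂ a p) × Consistent ((z , ρ p) ∷ L)
  place {L} con p = z , near , con′
    where
    at-p : Constraint → V G × ℕ
    at-p a = proj₁ a , proj₂ a p
    disks-meet : ∀ {x y} → x ∈ map at-p L → y ∈ map at-p L → d (proj₁ x) (proj₁ y) ≤ proj₂ x + proj₂ y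
    disks-meet x∈ y∈ with ∈-map⁻ at-p x∈ | ∈-map⁻ at-p y∈
    ... | _ , a∈ , refl | _ , b∈ , refl = close con a∈ b∈ p
    common = helly-family helly (map at-p L) disks-meet
    z = proj₁ common
    near : ∀ {a} → a ∈ L → d (proj₁ a) z ≤ proj₂ a p
    near a∈ = proj₂ common (∈-map⁺ at-p a∈)
    near-at : ∀ {a} → a ∈ L → ∀ q → d (proj₁ a) z ≤ proj₂ a q + ρ p q
    near-at {a} a∈ q = ℕₚ.≤-trans (near a∈) (subst (λ n → proj₂ a p ≤ proj₂ a q + n) (ρ-sym q p)
      (lipschitz con a∈ q p))
    con′ : Consistent ((z , ρ p) ∷ L)
    close con′ (here refl) (here refl) q = ℕₚ.≤-trans (ℕₚ.≤-reflexive (d-refl z)) z≤n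
    close con′ {b = b} (here refl) (there b∈) q =
      subst₂ _≤_ (d-sym _ z) (ℕₚ.+-comm (proj₂ b q) _) (near-at b∈ q)
    close con′ (there a∈) (here refl) q = near-at a∈ q
    close con′ (there a∈) (there b∈) q = close con a∈ b∈ q
    lipschitz con′ (here refl) q r = ρ-triangle p q r
    lipschitz con′ (there a∈) q r = lipschitz con a∈ q r

  extend : ∀ {L} → Consistent L → (xs : List Pt) → Σ (Pt → V G) λ f →
      (∀ {a p} → a ∈ L → p ∈ xs → d (proj₁ a) (f p) ≤ proj₂ a p)
    × (∀ {p q} → p ∈ xs → q ∈ xs → d (f p) (f q) ≤ ρ p q)
  -- Nothing is required outside the list, but `f` is total; `place` supplies a default vertex.
  extend con []       = (λ p → proj₁ (place con p)) , (λ _ ()) , (λ ())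
  extend con (p ∷ xs) = f , f-near , f-short
    where
    z = proj₁ (place con p)
    z-near = proj₁ (proj₂ (place con p))
    rest = extend (proj₂ (proj₂ (place con p))) xs
    _≟ᵖ_ = ≡-dec ℤₚ._≟_ ℤₚ._≟_
    -- If `p` occurs again in `xs`, its second image is ignored in favour of `z`.
    f : Pt → V G
    f q with q ≟ᵖ p
    ... | yes _ = z
    ... | no  _ = proj₁ rest q
    tail : ∀ {q} → q ∈ p ∷ xs → q ≢ p → q ∈ xs
    tail (here q≡p) q≢p = ⊥-elim (q≢p q≡p)
    tail (there q∈) q≢p = q∈
    f-near : ∀ {a q} → a ∈ _ → q ∈ p ∷ xs → d (proj₁ a) (f q) ≤ proj₂ a q
    f-near {q = q} a∈ q∈ with q ≟ᵖ p
    ... | yes refl = z-near a∈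
    ... | no  q≢p  = proj₁ (proj₂ rest) (there a∈) (tail q∈ q≢p)
    f-short : ∀ {q r} → q ∈ p ∷ xs → r ∈ p ∷ xs → d (f q) (f r) ≤ ρ q r
    f-short {q} {r} q∈ r∈ with q ≟ᵖ p | r ≟ᵖ p
    ... | yes refl | yes refl = ℕₚ.≤-trans (ℕₚ.≤-reflexive (d-refl z)) z≤n
    ... | yes refl | no  r≢p  = proj₁ (proj₂ rest) (here refl) (tail r∈ r≢p)
    ... | no  q≢p  | yes refl = subst₂ _≤_ (d-sym _ _) (ρ-sym r q) (proj₁ (proj₂ rest) (here refl) (tail q∈ q≢p))
    ... | no  q≢p  | no  r≢p  = proj₂ (proj₂ rest) (tail q∈ q≢p) (tail r∈ r≢p)

-- Finite lists covering bounded parts of the grid.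

ints : ℕ → List ℤ
ints zero    = + 0 ∷ []
ints (suc n) = + suc n ∷ -[1+ n ] ∷ ints n

∈-ints : ∀ n i → ∣ i ∣ ≤ n → i ∈ ints n
∈-ints zero    i h = here (ℤₚ.∣i∣≡0⇒i≡0 (ℕₚ.n≤0⇒n≡0 h))
∈-ints (suc n) i h with ℕₚ.m≤n⇒m<n∨m≡n h
∈-ints (suc n) i        h | inj₁ (s≤s h′) = there (there (∈-ints n i h′))
∈-ints (suc n) (+ _)    h | inj₂ refl     = here refl
∈-ints (suc n) -[1+ _ ] h | inj₂ refl     = there (here refl)

O : Pt
O = + 0 , + 0

ball : ℕ → List Pt
ball n = cartesianProduct (ints n) (ints n)

∈-ball : ∀ n p → ρ O p ≤ n → p ∈ ball n
∈-ball n p h = ∈-cartesianProduct⁺ (∈-ints n (proj₁ p) (coordinate (proj₁ p) (∣Δx∣≤ρ O p)))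
                                   (∈-ints n (proj₂ p) (coordinate (proj₂ p) (∣Δy∣≤ρ O p)))
  where
  coordinate : ∀ i → ∣ + 0 ℤ.- i ∣ ≤ ρ O p → ∣ i ∣ ≤ n
  coordinate i le = subst (_≤ n) (trans (cong ∣_∣ (ℤₚ.+-identityˡ (ℤ.- i))) (ℤₚ.∣-i∣≡∣i∣ i)) (ℕₚ.≤-trans le h)

-- Since `ρ≤walk` bounds every walk from below, this makes `ρ` the intrinsic distance of the
-- subgraph on `P`.
Isometric : (Pt → Set) → Set
Isometric P = ∀ (a b : Sub P) → Walk (KingSub P) a b (ρ (proj₁ a) (proj₁ b))

-- Isometric embeddings from weighted corners.

module Embedding (G : Graph) (d : V G → V G → ℕ) (isDist : IsDistFun G d) (helly : Helly G d) where
  open ShortestPath G d isDist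
  open Extension G d isDist helly
  open Consistent

  -- The weights w are the distances by which the images of the corners K may stay away from the centres c.
  module _ {P : Pt → Set} {m : ℕ} (K : Fin m → Pt) (c : Fin m → V G) (w : Fin m → ℕ)
           (upper : ∀ i j → d (c i) (c j) ≤ w i + w j + ρ (K i) (K j))
           (spanned : ∀ p q → P p → P q → ∃₂ λ i j → (w i + w j + ρ (K i) (K j) ≤ d (c i) (c j))
                                                  × (ρ (K i) p + ρ p q + ρ q (K j) ≤ ρ (K i) (K j)))
           (isometric : Isometric P) where

    constraint : Fin m → Constraint
    constraint i = c i , λ p → w i + ρ (K i) p

    consistent : Consistent (map constraint (allFin m))
    close consistent a∈ b∈ p with ∈-map⁻ constraint a∈ | ∈-map⁻ constraint b∈
    ... | i , _ , refl | j , _ , refl = begin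
      d (c i) (c j)                            ≤⟨ upper i j ⟩
      w i + w j + ρ (K i) (K j)                ≤⟨ ℕₚ.+-monoʳ-≤ (w i + w j) (ρ-triangle (K i) p (K j)) ⟩
      w i + w j + (ρ (K i) p + ρ p (K j))      ≡⟨ cong (λ n → w i + w j + (ρ (K i) p + n)) (ρ-sym p (K j)) ⟩
      w i + w j + (ρ (K i) p + ρ (K j) p)      ≡⟨ interchange (w i) (w j) _ _ ⟩
      (w i + ρ (K i) p) + (w j + ρ (K j) p)    ∎
      where
      open ℕₚ.≤-Reasoning
      interchange : ∀ a b x y → a + b + (x + y) ≡ (a + x) + (b + y)
      interchange = ℕ-Solver.solve-∀
    lipschitz consistent a∈ p q with ∈-map⁻ constraint a∈
    ... | i , _ , refl = subst (w i + ρ (K i) q ≤_) (sym (ℕₚ.+-assoc (w i) _ _))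
                           (ℕₚ.+-monoʳ-≤ (w i) (ρ-triangle (K i) p q))

    -- Only finitely many points can be placed. By `spanned p p` each point of `P` lies on a
    -- geodesic from some `K i` to some `K j`, hence no farther from `K i` than `K j` is.
    points : List Pt
    points = concatMap (λ i → concatMap (λ j → ball (ρ O (K i) + ρ (K i) (K j))) (allFin m)) (allFin m)

    ∈-points : ∀ p → P p → p ∈ points
    ∈-points p p∈ with spanned p p p∈ p∈
    ... | i , j , _ , le = ∈-concatMap⁺ _ (lose (∈-allFin i) (∈-concatMap⁺ _ (lose (∈-allFin j) (∈-ball _ p (begin
      ρ O p                          ≤⟨ ρ-triangle O (K i) p ⟩
      ρ O (K i) + ρ (K i) p          ≤⟨ ℕₚ.+-monoʳ-≤ (ρ O (K i)) 
                                          (ℕₚ.m+n≤o⇒m≤o _ (ℕₚ.m+n≤o⇒m≤o _ le)) ⟩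
      ρ O (K i) + ρ (K i) (K j)      ∎)))))
      where
      open ℕₚ.≤-Reasoning

    extension = extend consistent points

    f : Pt → V G
    f = proj₁ extension

    f-near : ∀ i {p} → P p → d (c i) (f p) ≤ w i + ρ (K i) p
    f-near i p∈ = proj₁ (proj₂ extension) (∈-map⁺ constraint (∈-allFin i)) (∈-points _ p∈)

    -- A squeeze: the path from `c i` to `c j` through `f p` and `f q` is at least as long as the
    -- tight value, and `f-near` bounds its outer legs, so the middle leg cannot be shorter than
    -- `ρ p q`.
    f-expands : ∀ {p q} → P p → P q → ρ p q ≤ d (f p) (f q)
    f-expands {p} {q} p∈ q∈ with spanned p q p∈ q∈
    ... | i , j , tight , between = ℕₚ.+-cancelˡ-≤ (w i + w j + ρ (K i) p + ρ q (K j)) _ _ (begin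
      w i + w j + ρ (K i) p + ρ q (K j) + ρ p q     ≡⟨ rearrange₁ (w i) (w j) _ _ _ ⟩
      w i + w j + (ρ (K i) p + ρ p q + ρ q (K j))   ≤⟨ ℕₚ.+-monoʳ-≤ (w i + w j) between ⟩
      w i + w j + ρ (K i) (K j)                     ≤⟨ tight ⟩
      d (c i) (c j)                                 ≤⟨ d-triangle (c i) (f p) (c j) ⟩
      d (c i) (f p) + d (f p) (c j)                 ≤⟨ ℕₚ.+-mono-≤ (f-near i p∈) (d-triangle (f p) (f q) (c j)) ⟩
      w i + ρ (K i) p + (d (f p) (f q) + d (f q) (c j))
        ≡⟨ cong (λ n → w i + ρ (K i) p + (d (f p) (f q) + n)) (d-sym (f q) (c j)) ⟩
      w i + ρ (K i) p + (d (f p) (f q) + d (c j) (f q))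
        ≤⟨ ℕₚ.+-monoʳ-≤ (w i + ρ (K i) p) (ℕₚ.+-monoʳ-≤ (d (f p) (f q)) (f-near j q∈)) ⟩
      w i + ρ (K i) p + (d (f p) (f q) + (w j + ρ (K j) q))
        ≡⟨ cong (λ n → w i + ρ (K i) p + (d (f p) (f q) + (w j + n))) (ρ-sym (K j) q) ⟩
      w i + ρ (K i) p + (d (f p) (f q) + (w j + ρ q (K j)))
        ≡⟨ rearrange₂ (w i) (w j) _ _ _ ⟩
      w i + w j + ρ (K i) p + ρ q (K j) + d (f p) (f q) ∎)
      where
      open ℕₚ.≤-Reasoning
      rearrange₁ : ∀ a b x y r → a + b + x + y + r ≡ a + b + (x + r + y)
      rearrange₁ = ℕ-Solver.solve-∀
      rearrange₂ : ∀ a b x y r → a + x + (r + (b + y)) ≡ a + b + x + y + r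
      rearrange₂ = ℕ-Solver.solve-∀

    f-isometric : ∀ {p q} → P p → P q → d (f p) (f q) ≡ ρ p q
    f-isometric p∈ q∈ = ℕₚ.≤-antisym (proj₂ (proj₂ extension) (∈-points _ p∈) (∈-points _ q∈)) (f-expands p∈ q∈)

    embed : ContainsIso P G d
    embed = (λ a → f (proj₁ a)) , injective , edges , distances
      where
      injective : ∀ a b → f (proj₁ a) ≡ f (proj₁ b) → proj₁ a ≡ proj₁ b
      injective (p , p∈) (q , q∈) eq = ρ≡0⇒≡ p q (trans (sym (f-isometric p∈ q∈))
        (trans (cong (d (f p)) (sym eq)) (d-refl (f p))))
      edges : ∀ a b → (KingSub P a b → E G (f (proj₁ a)) (f (proj₁ b)))
                    × (E G (f (proj₁ a)) (f (proj₁ b)) → KingSub P a b)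
      edges (p , p∈) (q , q∈) =
        (λ r → d≡1⇒E (trans (f-isometric p∈ q∈) r)) , (λ e → trans (sym (f-isometric p∈ q∈)) (E⇒d≡1 e))
      distances : ∀ a b k → IsDist (KingSub P) a b k → d (f (proj₁ a)) (f (proj₁ b)) ≡ k
      distances a@(p , p∈) b@(q , q∈) k (walk , shortest) =
        trans (f-isometric p∈ q∈) (ℕₚ.≤-antisym (ρ≤walk walk) (shortest _ (isometric a b)))

isometric⇒IsDist : ∀ {P} → Isometric P → ∀ a b → IsDist (KingSub P) a b (ρ (proj₁ a) (proj₁ b))
isometric⇒IsDist isometric a b = isometric a b , λ _ → ρ≤walk

-- Integer inequalities.

-- A linear inequality i ≤ j is proved by displaying j - i as a sum of nonnegative terms.
linear : ∀ {i j k} → 0ℤ ℤ.≤ k → j ℤ.- i ≡ k → i ℤ.≤ j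
linear 0≤k eq = ℤₚ.0≤i-j⇒j≤i (subst (0ℤ ℤ.≤_) (sym eq) 0≤k)

infixl 6 _⊕_
_⊕_ : ∀ {i j} → 0ℤ ℤ.≤ i → 0ℤ ℤ.≤ j → 0ℤ ℤ.≤ i ℤ.+ j
_⊕_ = ℤₚ.+-mono-≤

↑_ : ∀ {i j} → i ℤ.≤ j → 0ℤ ℤ.≤ j ℤ.- i
↑_ = ℤₚ.i≤j⇒0≤j-i

slack : ∀ n → 0ℤ ℤ.≤ + n
slack n = +≤+ z≤n

-- A double is even, so a bound that is one unit short suffices. The spare unit pays for the parity
-- losses in `gate-ls` and `weightsℤ`.
halve : ∀ i → ℤ.- 1ℤ ℤ.≤ i ℤ.+ i → 0ℤ ℤ.≤ i
halve (+ n)    h        = +≤+ z≤n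
halve -[1+ n ] (-≤- ())

≡⊎< : ∀ i j → i ℤ.≤ j → i ≡ j ⊎ i ℤ.+ 1ℤ ℤ.≤ j
≡⊎< i j i≤j with i ℤₚ.≟ j
... | yes i≡j = inj₁ i≡j
... | no  i≢j = inj₂ (subst (ℤ._≤ j) (ℤₚ.+-comm 1ℤ i) (ℤₚ.i<j⇒suc[i]≤j (ℤₚ.≤∧≢⇒< i≤j i≢j)))

-- The two cone orders and the geodesics of the king grid.

infix 4 _≼ˣ_ _≼ʸ_
-- The product order in the coordinates (s,t): `q` lies in the eastern cone of `p`, where the change
-- of y is at most the change of x. Reversing t gives the northern cone, `_≼ʸ_`, and any two points
-- are comparable in one of the two orders.
record _≼ˣ_ (p q : Pt) : Set where
  constructor _,_
  field
    s-≤ : proj₁ p ℤ.+ proj₂ p ℤ.≤ proj₁ q ℤ.+ proj₂ q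
    t-≤ : proj₁ p ℤ.- proj₂ p ℤ.≤ proj₁ q ℤ.- proj₂ q

record _≼ʸ_ (p q : Pt) : Set where
  constructor _,_
  field
    s-≤ : proj₁ p ℤ.+ proj₂ p ℤ.≤ proj₁ q ℤ.+ proj₂ q
    t-≥ : proj₁ q ℤ.- proj₂ q ℤ.≤ proj₁ p ℤ.- proj₂ p

≼ˣ-trans : ∀ {p q r} → p ≼ˣ q → q ≼ˣ r → p ≼ˣ r
≼ˣ-trans (h , g) (h′ , g′) = ℤₚ.≤-trans h h′ , ℤₚ.≤-trans g g′

≼ʸ-trans : ∀ {p q r} → p ≼ʸ q → q ≼ʸ r → p ≼ʸ r
≼ʸ-trans (h , g) (h′ , g′) = ℤₚ.≤-trans h h′ , ℤₚ.≤-trans g′ g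

≼ʸ⇒≼ˣ : ∀ {p q} → p ≼ʸ q → swap p ≼ˣ swap q
≼ʸ⇒≼ˣ {x , y} {x′ , y′} (h , g) = subst₂ ℤ._≤_ (ℤₚ.+-comm x y) (ℤₚ.+-comm x′ y′) h , antitone g
  where
  antitone : x′ ℤ.- y′ ℤ.≤ x ℤ.- y → y ℤ.- x ℤ.≤ y′ ℤ.- x′
  antitone g = linear (↑ g) (solve (x ∷ y ∷ x′ ∷ y′ ∷ []))

comparable : ∀ p q → (p ≼ˣ q ⊎ q ≼ˣ p) ⊎ (p ≼ʸ q ⊎ q ≼ʸ p)
comparable p q with ℤₚ.≤-total (s p) (s q) | ℤₚ.≤-total (t p) (t q)
... | inj₁ h | inj₁ g = inj₁ (inj₁ (h , g))
... | inj₁ h | inj₂ g = inj₂ (inj₁ (h , g))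
... | inj₂ h | inj₁ g = inj₂ (inj₂ (h , g))
... | inj₂ h | inj₂ g = inj₁ (inj₂ (h , g))

ρ-swap : ∀ p q → ρ (swap p) (swap q) ≡ ρ p q
ρ-swap (x , y) (x′ , y′) = ℕₚ.⊔-comm ∣ y ℤ.- y′ ∣ ∣ x ℤ.- x′ ∣

dominated : ∀ u v → 0ℤ ℤ.≤ u ℤ.+ v → 0ℤ ℤ.≤ u ℤ.- v → + (∣ u ∣ ⊔ ∣ v ∣) ≡ u
dominated u v h g with halve u (linear (h ⊕ g ⊕ slack 1) (solve (u ∷ v ∷ [])))
dominated (+ m) v h g | +≤+ _ = cong +_ (ℕₚ.m≥n⇒m⊔n≡m (bound v h g))
  where
  bound : ∀ v → 0ℤ ℤ.≤ + m ℤ.+ v → 0ℤ ℤ.≤ + m ℤ.- v → ∣ v ∣ ≤ m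
  bound (+ n)    h g = ℤₚ.drop‿+≤+ (ℤₚ.0≤i-j⇒j≤i g)
  bound -[1+ n ] h g = ℤₚ.drop‿+≤+ (ℤₚ.0≤i-j⇒j≤i h)

ρ-x : ∀ {p q} → p ≼ˣ q → + ρ p q ≡ proj₁ q ℤ.- proj₁ p
ρ-x {p@(x , y)} {q@(x′ , y′)} (h , g) = trans (cong +_ (ρ-sym p q)) (dominated (x′ ℤ.- x) (y′ ℤ.- y)
  (linear (↑ h) (solve (x ∷ y ∷ x′ ∷ y′ ∷ []))) (linear (↑ g) (solve (x ∷ y ∷ x′ ∷ y′ ∷ []))))

ρ-y : ∀ {p q} → p ≼ʸ q → + ρ p q ≡ proj₂ q ℤ.- proj₂ p
ρ-y {p} {q} p≼q = trans (cong +_ (sym (ρ-swap p q))) (ρ-x (≼ʸ⇒≼ˣ p≼q))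

-- On a chain `ρ` is the difference of first coordinates, which telescopes.
betweenˣ : ∀ {a p q b} → a ≼ˣ p → p ≼ˣ q → q ≼ˣ b → ρ a p + ρ p q + ρ q b ≤ ρ a b
betweenˣ {a} {p} {q} {b} a≼p p≼q q≼b = ℕₚ.≤-reflexive (ℤₚ.+-injective (begin
  + ρ a p ℤ.+ + ρ p q ℤ.+ + ρ q b
    ≡⟨ cong₂ ℤ._+_ (cong₂ ℤ._+_ (ρ-x a≼p) (ρ-x p≼q)) (ρ-x q≼b) ⟩
  (proj₁ p ℤ.- proj₁ a) ℤ.+ (proj₁ q ℤ.- proj₁ p) ℤ.+ (proj₁ b ℤ.- proj₁ q)
    ≡⟨ telescope (proj₁ a) (proj₁ p) (proj₁ q) (proj₁ b) ⟩
  proj₁ b ℤ.- proj₁ a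
    ≡⟨ sym (ρ-x (≼ˣ-trans a≼p (≼ˣ-trans p≼q q≼b))) ⟩
  + ρ a b ∎))
  where
  open ≡-Reasoning
  telescope : ∀ a p q b → (p ℤ.- a) ℤ.+ (q ℤ.- p) ℤ.+ (b ℤ.- q) ≡ b ℤ.- a
  telescope = solve-∀

betweenʸ : ∀ {a p q b} → a ≼ʸ p → p ≼ʸ q → q ≼ʸ b → ρ a p + ρ p q + ρ q b ≤ ρ a b
betweenʸ {a} {p} {q} {b} a≼p p≼q q≼b = subst₂ _≤_
  (cong₂ _+_ (cong₂ _+_ (ρ-swap a p) (ρ-swap p q)) (ρ-swap q b)) (ρ-swap a b)
  (betweenˣ (≼ʸ⇒≼ˣ a≼p) (≼ʸ⇒≼ˣ p≼q) (≼ʸ⇒≼ˣ q≼b))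

-- Order-convex sets are isometric.

King-shift : ∀ p u v → King (u , v) O → King p (proj₁ p ℤ.+ u , proj₂ p ℤ.+ v)
King-shift (x , y) u v unit = trans (cong₂ _⊔_ (reflect x u) (reflect y v)) unit
  where
  difference : ∀ i j → i ℤ.- (i ℤ.+ j) ≡ ℤ.- (j ℤ.- + 0)
  difference = solve-∀
  reflect : ∀ i j → ∣ i ℤ.- (i ℤ.+ j) ∣ ≡ ∣ j ℤ.- + 0 ∣
  reflect i j = trans (cong ∣_∣ (difference i j)) (ℤₚ.∣-i∣≡∣i∣ (j ℤ.- + 0))

record Stepˣ (p q : Pt) : Set where
  constructor step-to
  field
    next     : Pt
    adjacent : King p next
    above    : p ≼ˣ next
    below    : next ≼ˣ q
    advance  : proj₁ next ≡ proj₁ p ℤ.+ 1ℤ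

i<j⇒1+i≤j : ∀ {i j} → i ℤ.< j → 1ℤ ℤ.+ i ℤ.≤ j
i<j⇒1+i≤j = ℤₚ.i<j⇒suc[i]≤j

-- Moving one column east and, if the rows differ, one row towards `q` stays in the order interval
-- from `p` to `q`, hence in every convex set containing both.
stepˣ : ∀ p q → p ≼ˣ q → proj₁ p ℤ.+ 1ℤ ℤ.≤ proj₁ q → Stepˣ p q
stepˣ p@(x , y) (x′ , y′) (h , g) x<x′ with ℤₚ.<-cmp y y′
... | tri< y<y′ _ _ = step-to (x ℤ.+ + 1 , y ℤ.+ + 1) (King-shift p _ _ refl)
      (linear (slack 2) (solve (x ∷ y ∷ [])) , linear (slack 0) (solve (x ∷ y ∷ [])))
      (linear (↑ x<x′ ⊕ ↑ i<j⇒1+i≤j y<y′) (solve (x ∷ y ∷ x′ ∷ y′ ∷ [])) ,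
       linear (↑ g) (solve (x ∷ y ∷ x′ ∷ y′ ∷ [])))
      refl
... | tri≈ _ refl _ = step-to (x ℤ.+ + 1 , y ℤ.+ + 0) (King-shift p _ _ refl)
      (linear (slack 1) (solve (x ∷ y ∷ [])) , linear (slack 1) (solve (x ∷ y ∷ [])))
      (linear (↑ x<x′) (solve (x ∷ y ∷ x′ ∷ [])) , linear (↑ x<x′) (solve (x ∷ y ∷ x′ ∷ [])))
      refl
... | tri> _ _ y′<y = step-to (x ℤ.+ + 1 , y ℤ.+ -1ℤ) (King-shift p _ _ refl)
      (linear (slack 0) (solve (x ∷ y ∷ [])) , linear (slack 2) (solve (x ∷ y ∷ [])))
      (linear (↑ h) (solve (x ∷ y ∷ x′ ∷ y′ ∷ [])) ,
       linear (↑ x<x′ ⊕ ↑ i<j⇒1+i≤j y′<y) (solve (x ∷ y ∷ x′ ∷ y′ ∷ [])))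
      refl

-- Vertices of Sub P carry membership proofs, and two proofs for one point would be two vertices.
Unique : (Pt → Set) → Set
Unique P = ∀ p (h h′ : P p) → h ≡ h′

Convexˣ : (Pt → Set) → Set
Convexˣ P = ∀ {p q r} → P p → P r → p ≼ˣ q → q ≼ˣ r → P q

walkˣ : ∀ {P} → Unique P → Convexˣ P → ∀ n {p q} (p∈ : P p) (q∈ : P q) → p ≼ˣ q →
        proj₁ q ℤ.- proj₁ p ≡ + n → Walk (KingSub P) (p , p∈) (q , q∈) n
walkˣ unique convex zero {p} {q} p∈ q∈ p≼q eq
  with ρ≡0⇒≡ p q (ℤₚ.+-injective (trans (ρ-x p≼q) eq))
... | refl with unique p p∈ q∈
... | refl = here
walkˣ unique convex (suc n) {p} {q} p∈ q∈ p≼q eq =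
  step adjacent (walkˣ unique convex n (convex p∈ q∈ above below) q∈ below remaining)
  where
  subtract : ∀ i j → j ℤ.- (i ℤ.+ 1ℤ) ≡ (j ℤ.- i) ℤ.- 1ℤ
  subtract = solve-∀
  shorter : proj₁ q ℤ.- (proj₁ p ℤ.+ 1ℤ) ≡ + n
  shorter = trans (subtract (proj₁ p) (proj₁ q)) (cong (ℤ._- 1ℤ) eq)
  open Stepˣ (stepˣ p q p≼q (linear (slack n) shorter))
  remaining : proj₁ q ℤ.- proj₁ next ≡ + n
  remaining = trans (cong (λ x → proj₁ q ℤ.- x) advance) shorter

-- Two points are comparable in one of the orders, and convexity keeps the stepwise walk inside. The
-- northern case is the eastern one for the swapped set, mapped back.
convex-isometric : ∀ {P} → Unique P → Convexˣ P → Convexˣ (λ p → P (swap p)) → Isometric P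
convex-isometric {P} unique convex convex′ (p , p∈) (q , q∈) = by-order (comparable p q)
  where
  along-x : ∀ {p q} (p∈ : P p) (q∈ : P q) → p ≼ˣ q → Walk (KingSub P) (p , p∈) (q , q∈) (ρ p q)
  along-x p∈ q∈ p≼q = walkˣ unique convex _ p∈ q∈ p≼q (sym (ρ-x p≼q))
  along-y : ∀ {p q} (p∈ : P p) (q∈ : P q) → p ≼ʸ q → Walk (KingSub P) (p , p∈) (q , q∈) (ρ p q)
  along-y {p} {q} p∈ q∈ p≼q = subst (Walk (KingSub P) _ _) (ρ-swap p q)
    (mapʷ {R = KingSub (λ p → P (swap p))} {KingSub P} (λ (p , p∈) → swap p , p∈)
      (λ {a} {b} r → trans (ρ-swap (proj₁ a) (proj₁ b)) r)
      (walkˣ {λ p → P (swap p)} (λ p → unique (swap p)) convex′ _ p∈ q∈ (≼ʸ⇒≼ˣ p≼q) (sym (ρ-x (≼ʸ⇒≼ˣ p≼q)))))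
  back : ∀ {p q} {p∈ : P p} {q∈ : P q} → Walk (KingSub P) (q , q∈) (p , p∈) (ρ q p) →
         Walk (KingSub P) (p , p∈) (q , q∈) (ρ p q)
  back {p} {q} w = subst (Walk (KingSub P) _ _) (ρ-sym q p)
    (reverseʷ (λ {a} {b} → King-sym {proj₁ a} {proj₁ b}) w)
  by-order : (p ≼ˣ q ⊎ q ≼ˣ p) ⊎ (p ≼ʸ q ⊎ q ≼ʸ p) → Walk (KingSub P) (p , p∈) (q , q∈) (ρ p q)
  by-order (inj₁ (inj₁ p≼q)) = along-x p∈ q∈ p≼q
  by-order (inj₁ (inj₂ q≼p)) = back (along-x q∈ p∈ q≼p)
  by-order (inj₂ (inj₁ p≼q)) = along-y p∈ q∈ p≼q
  by-order (inj₂ (inj₂ q≼p)) = back (along-y q∈ p∈ q≼p)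

-- Rectangles in the coordinates (s,t).

Box : ℤ → ℤ → ℤ → ℤ → Pt → Set
Box ls hs lt ht p = (ls ℤ.≤ proj₁ p ℤ.+ proj₂ p) × (proj₁ p ℤ.+ proj₂ p ℤ.≤ hs)
                  × (lt ℤ.≤ proj₁ p ℤ.- proj₂ p) × (proj₁ p ℤ.- proj₂ p ℤ.≤ ht)

Box-unique : ∀ {ls hs lt ht} → Unique (Box ls hs lt ht)
Box-unique _ (a , b , c , e) (a′ , b′ , c′ , e′) = cong₂ _,_ (ℤₚ.≤-irrelevant a a′)
  (cong₂ _,_ (ℤₚ.≤-irrelevant b b′) (cong₂ _,_ (ℤₚ.≤-irrelevant c c′) (ℤₚ.≤-irrelevant e e′)))

Box-convex : ∀ {ls hs lt ht} → Convexˣ (Box ls hs lt ht)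
Box-convex (a , _ , c , _) (_ , b , _ , e) (h , g) (h′ , g′) =
  ℤₚ.≤-trans a h , ℤₚ.≤-trans h′ b , ℤₚ.≤-trans c g , ℤₚ.≤-trans g′ e

Box-swap : ∀ {ls hs lt ht} p → Box ls hs lt ht p → Box ls hs (ℤ.- ht) (ℤ.- lt) (swap p)
Box-swap {ls} {hs} {lt} {ht} (x , y) (a , b , c , e) =
  subst (ls ℤ.≤_) (ℤₚ.+-comm x y) a , subst (ℤ._≤ hs) (ℤₚ.+-comm x y) b ,
  upper e , lower c
  where
  upper : x ℤ.- y ℤ.≤ ht → ℤ.- ht ℤ.≤ y ℤ.- x
  upper e = linear (↑ e) (solve (x ∷ y ∷ ht ∷ []))
  lower : lt ℤ.≤ x ℤ.- y → y ℤ.- x ℤ.≤ ℤ.- lt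
  lower c = linear (↑ c) (solve (x ∷ y ∷ lt ∷ []))

Box-unswap : ∀ {ls hs lt ht} p → Box ls hs (ℤ.- ht) (ℤ.- lt) p → Box ls hs lt ht (swap p)
Box-unswap {ls} {hs} {lt} {ht} p h =
  subst₂ (λ l h → Box ls hs l h (swap p)) (ℤₚ.neg-involutive lt) (ℤₚ.neg-involutive ht) (Box-swap p h)

Box-isometric : ∀ {ls hs lt ht} → Isometric (Box ls hs lt ht)
Box-isometric {ls} {hs} {lt} {ht} = convex-isometric Box-unique Box-convex
  (λ {p} {q} {r} p∈ r∈ p≼q q≼r → Box-unswap q (Box-convex (Box-swap (swap p) p∈) (Box-swap (swap r) r∈) p≼q q≼r))

-- Points attached just outside a box.

mirror : Pt → Pt
mirror (x , y) = x , ℤ.- y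

ρ-mirror : ∀ p q → ρ (mirror p) (mirror q) ≡ ρ p q
ρ-mirror (x , y) (x′ , y′) = cong (∣ x ℤ.- x′ ∣ ⊔_)
  (trans (cong ∣_∣ (negate y y′)) (ℤₚ.∣-i∣≡∣i∣ (y ℤ.- y′)))
  where
  negate : ∀ i j → ℤ.- i ℤ.- ℤ.- j ≡ ℤ.- (i ℤ.- j)
  negate = solve-∀

Box-mirror : ∀ {ls hs lt ht} p → Box ls hs lt ht p → Box lt ht ls hs (mirror p)
Box-mirror {ls} {hs} (x , y) (a , b , c , e) =
  c , e , subst (ls ℤ.≤_) unfold a , subst (ℤ._≤ hs) unfold b
  where
  unfold : x ℤ.+ y ≡ x ℤ.- ℤ.- y
  unfold = cong (λ z → x ℤ.+ z) (sym (ℤₚ.neg-involutive y))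

-- For every target in `B` some geodesic from `c` enters `B` with its first step. Attaching such a
-- `c` to an isometric `B` therefore keeps distances from `c` to `B` intrinsic.
record Gate (B : Pt → Set) (c : Pt) : Set where
  constructor gate
  field enter : ∀ q → B q → ∃ λ p → B p × King c p × ρ c q ≡ suc (ρ p q)
open Gate

-- An involutive isometry `φ` exchanging the two sets carries gates along, so one position at one
-- vertex of the box suffices.
gate-transport : ∀ {B B′} (φ : Pt → Pt) → (∀ p → φ (φ p) ≡ p) → (∀ p q → ρ (φ p) (φ q) ≡ ρ p q) →
                 (∀ p → B p → B′ (φ p)) → (∀ p → B′ p → B (φ p)) → ∀ {c} → Gate B (φ c) → Gate B′ c
enter (gate-transport φ φφ φ-ρ to from {c} (gate enter-φ)) q q∈ with enter-φ (φ q) (from q q∈)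
... | p , p∈ , adjacent , nearer = φ p , to p p∈ ,
  trans (cong (λ z → ρ z (φ p)) (sym (φφ c))) (trans (φ-ρ (φ c) p) adjacent) ,
  trans (sym (φ-ρ c q)) (trans nearer (cong suc (trans (sym (φ-ρ p (φ q))) (cong (ρ (φ p)) (φφ q)))))

gate-mirror : ∀ {ls hs lt ht c} → Gate (Box lt ht ls hs) (mirror c) → Gate (Box ls hs lt ht) c
gate-mirror = gate-transport mirror (λ p → cong (proj₁ p ,_) (ℤₚ.neg-involutive (proj₂ p))) ρ-mirror
  Box-mirror Box-mirror

gate-swap : ∀ {ls hs lt ht c} → Gate (Box ls hs (ℤ.- ht) (ℤ.- lt)) (swap c) → Gate (Box ls hs lt ht) c
gate-swap = gate-transport swap (λ _ → refl) ρ-swap Box-unswap Box-swap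

ρ-advance : ∀ c p q → c ≼ˣ q → p ≼ˣ q → proj₁ p ≡ proj₁ c ℤ.+ 1ℤ → ρ c q ≡ suc (ρ p q)
ρ-advance c p q c≼q p≼q eq = ℤₚ.+-injective (begin
  + ρ c q                                       ≡⟨ ρ-x c≼q ⟩
  proj₁ q ℤ.- proj₁ c                           ≡⟨ split (proj₁ c) (proj₁ q) ⟩
  1ℤ ℤ.+ (proj₁ q ℤ.- (proj₁ c ℤ.+ 1ℤ))         ≡⟨ cong (λ x → 1ℤ ℤ.+ (proj₁ q ℤ.- x)) (sym eq) ⟩
  1ℤ ℤ.+ (proj₁ q ℤ.- proj₁ p)                  ≡⟨ cong (λ z → 1ℤ ℤ.+ z) (sym (ρ-x p≼q)) ⟩
  + suc (ρ p q)                                 ∎)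
  where
  open ≡-Reasoning
  split : ∀ c q → q ℤ.- c ≡ 1ℤ ℤ.+ (q ℤ.- (c ℤ.+ 1ℤ))
  split = solve-∀

-- In the coordinates (s,t) the vertex (ls,lt) of the box has the wrong parity to be a point; c lies one unit
-- outside it, as the extra points of H2 and H3 do.
gate-ls : ∀ {ls hs lt ht} c → ls ≡ proj₁ c ℤ.+ proj₂ c ℤ.+ 1ℤ → lt ≡ proj₁ c ℤ.- proj₂ c →
          ls ℤ.+ 1ℤ ℤ.≤ hs → lt ℤ.+ 1ℤ ℤ.≤ ht → Gate (Box ls hs lt ht) c
enter (gate-ls {hs = hs} {ht = ht} (x , y) refl refl ls<hs lt<ht) (a , b) (l₁ , l₂ , l₃ , l₄)
  with ≡⊎< (x ℤ.- y) (a ℤ.- b) l₃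
-- If `q` lies on the side t = `lt`, the step must keep t and so raises s by 2. There is room,
-- because s and t of a point have equal parity; `x<a` extracts this by `halve`.
... | inj₁ eq = (x ℤ.+ 1ℤ , y ℤ.+ 1ℤ) ,
      (linear (slack 1) (solve (x ∷ y ∷ [])) , linear (↑ ls<hs) (solve (x ∷ y ∷ hs ∷ [])) ,
       linear (slack 0) (solve (x ∷ y ∷ [])) , linear (↑ lt<ht ⊕ slack 1) (solve (x ∷ y ∷ ht ∷ []))) ,
      King-shift (x , y) _ _ refl ,
      ρ-advance (x , y) (x ℤ.+ 1ℤ , y ℤ.+ 1ℤ) (a , b) (linear (↑ l₁ ⊕ slack 1) (solve (x ∷ y ∷ a ∷ b ∷ [])) , l₃)
             (linear (x<a ⊕ x<a ⊕ ↑ ℤₚ.≤-reflexive (sym eq)) (solve (x ∷ y ∷ a ∷ b ∷ [])) ,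
              linear (↑ l₃) (solve (x ∷ y ∷ a ∷ b ∷ [])))
             refl
  where
  x<a : 0ℤ ℤ.≤ a ℤ.- x ℤ.- 1ℤ
  x<a = halve (a ℤ.- x ℤ.- 1ℤ) (linear (↑ l₁ ⊕ ↑ l₃) (solve (x ∷ y ∷ a ∷ b ∷ [])))
-- Off that side the horizontal step, raising s and t by one each, does not pass `q`.
... | inj₂ lt = (x ℤ.+ 1ℤ , y ℤ.+ 0ℤ) ,
      (linear (slack 0) (solve (x ∷ y ∷ [])) , linear (↑ ls<hs ⊕ slack 1) (solve (x ∷ y ∷ hs ∷ [])) ,
       linear (slack 1) (solve (x ∷ y ∷ [])) , linear (↑ lt<ht) (solve (x ∷ y ∷ ht ∷ []))) ,
      King-shift (x , y) _ _ refl ,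
      ρ-advance (x , y) (x ℤ.+ 1ℤ , y ℤ.+ 0ℤ) (a , b) (linear (↑ l₁ ⊕ slack 1) (solve (x ∷ y ∷ a ∷ b ∷ [])) , l₃)
             (linear (↑ l₁) (solve (x ∷ y ∷ a ∷ b ∷ [])) , linear (↑ lt) (solve (x ∷ y ∷ a ∷ b ∷ [])))
             refl

sum-comm-1 : ∀ x y → x ℤ.+ y ℤ.+ 1ℤ ≡ y ℤ.+ x ℤ.+ 1ℤ
sum-comm-1 = solve-∀

neg-difference : ∀ x y → ℤ.- (x ℤ.- y) ≡ y ℤ.- x
neg-difference = solve-∀

neg-difference-1 : ∀ x y → ℤ.- (x ℤ.- y ℤ.- 1ℤ) ≡ y ℤ.- x ℤ.+ 1ℤ
neg-difference-1 = solve-∀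

sub-neg : ∀ x y → x ℤ.+ y ≡ x ℤ.- ℤ.- y
sub-neg = solve-∀

neg-gap : ∀ lt ht → lt ℤ.+ 1ℤ ℤ.≤ ht → ℤ.- ht ℤ.+ 1ℤ ℤ.≤ ℤ.- lt
neg-gap lt ht h = linear (↑ h) (solve (lt ∷ ht ∷ []))

-- The other positions, obtained from gate-ls by exchanging s and t (mirror) or negating t (swap).
gate-lt : ∀ {ls hs lt ht} c → ls ≡ proj₁ c ℤ.+ proj₂ c → lt ≡ proj₁ c ℤ.- proj₂ c ℤ.+ 1ℤ →
          ls ℤ.+ 1ℤ ℤ.≤ hs → lt ℤ.+ 1ℤ ℤ.≤ ht → Gate (Box ls hs lt ht) c
gate-lt c@(x , y) es et sz tz = gate-mirror (gate-ls (mirror c) et (trans es (sub-neg x y)) tz sz)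

gate-ls′ : ∀ {ls hs lt ht} c → ls ≡ proj₁ c ℤ.+ proj₂ c ℤ.+ 1ℤ → ht ≡ proj₁ c ℤ.- proj₂ c →
           ls ℤ.+ 1ℤ ℤ.≤ hs → lt ℤ.+ 1ℤ ℤ.≤ ht → Gate (Box ls hs lt ht) c
gate-ls′ c@(x , y) es et sz tz = gate-swap (gate-ls (swap c) (trans es (sum-comm-1 x y))
  (trans (cong ℤ.-_ et) (neg-difference x y)) sz (neg-gap _ _ tz))

gate-lt′ : ∀ {ls hs lt ht} c → hs ≡ proj₁ c ℤ.+ proj₂ c → lt ≡ proj₁ c ℤ.- proj₂ c ℤ.+ 1ℤ →
           ls ℤ.+ 1ℤ ℤ.≤ hs → lt ℤ.+ 1ℤ ℤ.≤ ht → Gate (Box ls hs lt ht) c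
gate-lt′ c@(x , y) es et sz tz = gate-mirror (gate-ls′ (mirror c) et (trans es (sub-neg x y)) tz sz)

gate-ht : ∀ {ls hs lt ht} c → ls ≡ proj₁ c ℤ.+ proj₂ c → ht ≡ proj₁ c ℤ.- proj₂ c ℤ.- 1ℤ →
          ls ℤ.+ 1ℤ ℤ.≤ hs → lt ℤ.+ 1ℤ ℤ.≤ ht → Gate (Box ls hs lt ht) c
gate-ht c@(x , y) es et sz tz = gate-swap (gate-lt (swap c) (trans es (ℤₚ.+-comm x y))
  (trans (cong ℤ.-_ et) (neg-difference-1 x y)) sz (neg-gap _ _ tz))

gate-ht′ : ∀ {ls hs lt ht} c → hs ≡ proj₁ c ℤ.+ proj₂ c → ht ≡ proj₁ c ℤ.- proj₂ c ℤ.- 1ℤ →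
           ls ℤ.+ 1ℤ ℤ.≤ hs → lt ℤ.+ 1ℤ ℤ.≤ ht → Gate (Box ls hs lt ht) c
gate-ht′ c@(x , y) es et sz tz = gate-swap (gate-lt′ (swap c) (trans es (ℤₚ.+-comm x y))
  (trans (cong ℤ.-_ et) (neg-difference-1 x y)) sz (neg-gap _ _ tz))

gate-hs : ∀ {ls hs lt ht} c → hs ≡ proj₁ c ℤ.+ proj₂ c ℤ.- 1ℤ → lt ≡ proj₁ c ℤ.- proj₂ c →
          ls ℤ.+ 1ℤ ℤ.≤ hs → lt ℤ.+ 1ℤ ℤ.≤ ht → Gate (Box ls hs lt ht) c
gate-hs c@(x , y) es et sz tz =
  gate-mirror (gate-ht (mirror c) et (trans es (cong (ℤ._- 1ℤ) (sub-neg x y))) tz sz)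

gate-hs′ : ∀ {ls hs lt ht} c → hs ≡ proj₁ c ℤ.+ proj₂ c ℤ.- 1ℤ → ht ≡ proj₁ c ℤ.- proj₂ c →
           ls ℤ.+ 1ℤ ℤ.≤ hs → lt ℤ.+ 1ℤ ℤ.≤ ht → Gate (Box ls hs lt ht) c
gate-hs′ c@(x , y) es et sz tz =
  gate-mirror (gate-ht′ (mirror c) et (trans es (cong (ℤ._- 1ℤ) (sub-neg x y))) tz sz)

-- Shortest walks in a box with extra points.

module Attach {P B : Pt → Set} (unique : Unique P) (include : ∀ p → B p → P p) (isometric : Isometric B) where
  Joined : Pt → Pt → Set
  Joined p q = ∀ (p∈ : P p) (q∈ : P q) → Walk (KingSub P) (p , p∈) (q , q∈) (ρ p q)

  joined-refl : ∀ p → Joined p p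
  joined-refl p p∈ p∈′ rewrite ρ-refl p | unique p p∈ p∈′ = here

  joined-sym : ∀ {p q} → Joined p q → Joined q p
  joined-sym {p} {q} w q∈ p∈ = subst (Walk (KingSub P) _ _) (ρ-sym p q)
    (reverseʷ (λ {a} {b} → King-sym {proj₁ a} {proj₁ b}) (w p∈ q∈))

  joined-box : ∀ {p q} → B p → B q → Joined p q
  joined-box {p} {q} p∈B q∈B p∈ q∈ = subst₂ (λ h h′ → Walk (KingSub P) (p , h) (q , h′) (ρ p q))
    (unique p _ p∈) (unique q _ q∈)
    (mapʷ (λ (p , p∈) → p , include p p∈) (λ r → r) (isometric (p , p∈B) (q , q∈B)))

  joined-via : ∀ {c p q} → B p → King c p → ρ c q ≡ suc (ρ p q) → Joined p q → Joined c q
  joined-via {c} {p} {q} p∈B adjacent nearer w c∈ q∈ =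
    subst (Walk (KingSub P) _ _) (sym nearer) (step adjacent (w (include p p∈B) q∈))

  joined-gate : ∀ {c q} → Gate B c → B q → Joined c q
  joined-gate g q∈B with Gate.enter g _ q∈B
  ... | p , p∈B , adjacent , nearer = joined-via p∈B adjacent nearer (joined-box p∈B q∈B)

  -- For two extra points: the first step enters the box at `p`, and the gate of `c′`, used
  -- backwards, completes the walk.
  joined-corners : ∀ {c} p {c′} → Gate B c′ → B p → King c p → ρ c c′ ≡ suc (ρ p c′) → Joined c c′
  joined-corners p g p∈B adjacent nearer =
    joined-via p∈B adjacent nearer (joined-sym (joined-gate g p∈B))

-- Points spanned by the corners of a quadrilateral.

-- The diagonals of a quadrilateral join 0F to 1F and 2F to 3F.
quadrilateral : {A : Set} → A → A → A → A → Fin 4 → A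
quadrilateral w e s n 0F = w
quadrilateral w e s n 1F = e
quadrilateral w e s n 2F = s
quadrilateral w e s n 3F = n

data Opposite : Fin 4 → Fin 4 → Set where
  we : Opposite 0F 1F
  ew : Opposite 1F 0F
  sn : Opposite 2F 3F
  ns : Opposite 3F 2F

-- `T` selects the pairs of corners whose distance has to be attained exactly in the embedding: the
-- opposite ones for `H1` and `H2`, all distinct ones for `H3`.
module Spans (T : Fin 4 → Fin 4 → Set) (diagonal : ∀ {i j} → Opposite i j → T i j)
             (T-sym : ∀ {i j} → T i j → T j i) (W E S N : Pt) where

  K = quadrilateral W E S N

  Span : Pt → Pt → Set
  Span p q = ∃₂ λ i j → T i j × (ρ (K i) p + ρ p q + ρ q (K j) ≤ ρ (K i) (K j))

  span-sym : ∀ p q → Span p q → Span q p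
  span-sym p q (i , j , tij , le) = j , i , T-sym tij , (begin
    ρ (K j) q + ρ q p + ρ p (K i)    ≡⟨ cong₂ _+_ (cong₂ _+_ (ρ-sym (K j) q) (ρ-sym q p)) (ρ-sym p (K i)) ⟩
    ρ q (K j) + ρ p q + ρ (K i) p    ≡⟨ turn (ρ q (K j)) _ _ ⟩
    ρ (K i) p + ρ p q + ρ q (K j)    ≤⟨ le ⟩
    ρ (K i) (K j)                    ≡⟨ ρ-sym (K i) (K j) ⟩
    ρ (K j) (K i)                    ∎)
    where
    open ℕₚ.≤-Reasoning
    turn : ∀ a b c → a + b + c ≡ c + b + a
    turn = ℕ-Solver.solve-∀

  spanˣ : ∀ {p q} → W ≼ˣ p → p ≼ˣ q → q ≼ˣ E → Span p q
  spanˣ h g k = 0F , 1F , diagonal we , betweenˣ h g k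

  spanʸ : ∀ {p q} → S ≼ʸ p → p ≼ʸ q → q ≼ʸ N → Span p q
  spanʸ h g k = 2F , 3F , diagonal sn , betweenʸ h g k

  span-corners : ∀ {i j} → T i j → Span (K i) (K j)
  span-corners {i} {j} tij = i , j , tij , ℕₚ.≤-reflexive (cong₂ _+_
    (cong (_+ ρ (K i) (K j)) (ρ-refl (K i))) (ρ-refl (K j)) ⟨ trans ⟩ ℕₚ.+-identityʳ _)
    where open import Function using (_⟨_⟩_)

  module _ {B : Pt → Set} (W≼ : ∀ p → B p → W ≼ˣ p) (≼E : ∀ p → B p → p ≼ˣ E)
           (S≼ : ∀ p → B p → S ≼ʸ p) (≼N : ∀ p → B p → p ≼ʸ N) where
    -- Comparable points extend to a chain from west to east or from south to north, and chains are
    -- geodesics.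
    span-box : ∀ {p q} → B p → B q → Span p q
    span-box {p} {q} p∈ q∈ with comparable p q
    ... | inj₁ (inj₁ p≼q) = spanˣ (W≼ p p∈) p≼q (≼E q q∈)
    ... | inj₁ (inj₂ q≼p) = span-sym q p (spanˣ (W≼ q q∈) q≼p (≼E p p∈))
    ... | inj₂ (inj₁ p≼q) = spanʸ (S≼ p p∈) p≼q (≼N q q∈)
    ... | inj₂ (inj₂ q≼p) = span-sym q p (spanʸ (S≼ q q∈) q≼p (≼N p p∈))

-- What is used about each family: the corner distances determine the gap of the corners, and
-- `spanned` with `isometric` allows the family to be embedded.
record Shape (P : Pt → Set) (T : Fin 4 → Fin 4 → Set) (diagonalˣ diagonalʸ side : ℕ) : Set where
  field
    corner    : Fin 4 → Pt
    corner∈   : ∀ i → P (corner i)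
    WE        : ρ (corner 0F) (corner 1F) ≡ diagonalˣ
    SN        : ρ (corner 2F) (corner 3F) ≡ diagonalʸ
    WS        : ρ (corner 0F) (corner 2F) ≡ side
    WN        : ρ (corner 0F) (corner 3F) ≡ side
    ES        : ρ (corner 1F) (corner 2F) ≡ side
    EN        : ρ (corner 1F) (corner 3F) ≡ side
    spanned   : ∀ p q → P p → P q →
                ∃₂ λ i j → T i j × (ρ (corner i) p + ρ p q + ρ q (corner j) ≤ ρ (corner i) (corner j))
    isometric : Isometric P

ρ-x≡ : ∀ {p q n} → p ≼ˣ q → proj₁ q ℤ.- proj₁ p ≡ + n → ρ p q ≡ n
ρ-x≡ p≼q eq = ℤₚ.+-injective (trans (ρ-x p≼q) eq)

ρ-y≡ : ∀ {p q n} → p ≼ʸ q → proj₂ q ℤ.- proj₂ p ≡ + n → ρ p q ≡ n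
ρ-y≡ p≼q eq = ℤₚ.+-injective (trans (ρ-y p≼q) eq)

opposite-sym : ∀ {i j} → Opposite i j → Opposite j i
opposite-sym we = ew
opposite-sym ew = we
opposite-sym sn = ns
opposite-sym ns = sn

module _ {ls hs lt ht : ℤ} {c : Pt} where
  west≼ : proj₁ c ℤ.+ proj₂ c ℤ.≤ ls → proj₁ c ℤ.- proj₂ c ℤ.≤ lt → ∀ p → Box ls hs lt ht p → c ≼ˣ p
  west≼ h g _ (a , _ , b , _) = ℤₚ.≤-trans h a , ℤₚ.≤-trans g b

  ≼east : hs ℤ.≤ proj₁ c ℤ.+ proj₂ c → ht ℤ.≤ proj₁ c ℤ.- proj₂ c → ∀ p → Box ls hs lt ht p → p ≼ˣ c
  ≼east h g _ (_ , a , _ , b) = ℤₚ.≤-trans a h , ℤₚ.≤-trans b g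

  south≼ : proj₁ c ℤ.+ proj₂ c ℤ.≤ ls → ht ℤ.≤ proj₁ c ℤ.- proj₂ c → ∀ p → Box ls hs lt ht p → c ≼ʸ p
  south≼ h g _ (a , _ , _ , b) = ℤₚ.≤-trans h a , ℤₚ.≤-trans b g

  ≼north : hs ℤ.≤ proj₁ c ℤ.+ proj₂ c → proj₁ c ℤ.- proj₂ c ℤ.≤ lt → ∀ p → Box ls hs lt ht p → p ≼ʸ c
  ≼north h g _ (_ , a , b , _) = ℤₚ.≤-trans a h , ℤₚ.≤-trans g b

module _ {ls hs lt ht : ℤ} where
  box-at : ∀ c {σ τ} → proj₁ c ℤ.+ proj₂ c ≡ σ → proj₁ c ℤ.- proj₂ c ≡ τ →
           ls ℤ.≤ σ → σ ℤ.≤ hs → lt ℤ.≤ τ → τ ℤ.≤ ht → Box ls hs lt ht c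
  box-at _ refl refl a b e f = a , b , e , f

-- `2 * m` unfolds to `m + (m + 0)`, whence the zeros in these identities.
double : ∀ i → i ℤ.+ i ≡ i ℤ.+ (i ℤ.+ 0ℤ)
double = solve-∀

double⁻ : ∀ i → i ℤ.- ℤ.- i ≡ i ℤ.+ (i ℤ.+ 0ℤ)
double⁻ = solve-∀

undouble : ∀ i → i ℤ.+ (i ℤ.+ 0ℤ) ℤ.- i ≡ i
undouble = solve-∀

overshoot : ∀ i → i ℤ.- (i ℤ.+ 1ℤ) ≡ -1ℤ
overshoot = solve-∀

cancel-1 : ∀ i → i ≡ i ℤ.+ 1ℤ ℤ.- 1ℤ
cancel-1 = solve-∀

-- The family `H1`: a box containing its corners.

H1-shape : ∀ m → Shape (H1 m) Opposite (2 * m) (2 * m) m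
H1-shape m = record
  { corner    = K
  ; corner∈   = λ { 0F → W∈ ; 1F → E∈ ; 2F → S∈ ; 3F → N∈ }
  ; WE        = ρ-x≡ (W≼ east E∈) (ℤₚ.+-identityʳ (+ (2 * m)))
  ; SN        = ρ-y≡ (S≼ north N∈) (double⁻ (+ m))
  ; WS        = ρ-x≡ (W≼ south S∈) (ℤₚ.+-identityʳ (+ m))
  ; WN        = ρ-x≡ (W≼ north N∈) (ℤₚ.+-identityʳ (+ m))
  ; ES        = trans (ρ-sym east south) (ρ-x≡ (≼E south S∈) (undouble (+ m)))
  ; EN        = trans (ρ-sym east north) (ρ-x≡ (≼E north N∈) (undouble (+ m)))
  ; spanned   = λ p q p∈ q∈ → span-box W≼ ≼E S≼ ≼N p∈ q∈
  ; isometric = Box-isometric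
  }
  where
  west east south north : Pt
  west = + 0 , + 0
  east = + (2 * m) , + 0
  south = + m , ℤ.- + m
  north = + m , + m
  open Spans Opposite (λ o → o) opposite-sym west east south north
  0≤2m : + 0 ℤ.≤ + (2 * m)
  0≤2m = +≤+ z≤n
  Square : Pt → Set
  Square = Box (+ 0) (+ (2 * m)) (+ 0) (+ (2 * m))
  W∈ : Square west
  W∈ = box-at west refl refl ℤₚ.≤-refl 0≤2m ℤₚ.≤-refl 0≤2m
  E∈ : Square east
  E∈ = box-at east (ℤₚ.+-identityʳ _) (ℤₚ.+-identityʳ _) 0≤2m ℤₚ.≤-refl 0≤2m ℤₚ.≤-refl
  S∈ : Square south
  S∈ = box-at south (ℤₚ.+-inverseʳ (+ m)) (double⁻ (+ m)) ℤₚ.≤-refl 0≤2m 0≤2m ℤₚ.≤-refl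
  N∈ : Square north
  N∈ = box-at north (double (+ m)) (ℤₚ.+-inverseʳ (+ m)) 0≤2m ℤₚ.≤-refl ℤₚ.≤-refl 0≤2m
  W≼ : ∀ p → Square p → west ≼ˣ p
  W≼ = west≼ ℤₚ.≤-refl ℤₚ.≤-refl
  ≼E : ∀ p → Square p → p ≼ˣ east
  ≼E = ≼east (ℤₚ.≤-reflexive (sym (ℤₚ.+-identityʳ _))) (ℤₚ.≤-reflexive (sym (ℤₚ.+-identityʳ _)))
  S≼ : ∀ p → Square p → south ≼ʸ p
  S≼ = south≼ (ℤₚ.≤-reflexive (ℤₚ.+-inverseʳ (+ m))) (ℤₚ.≤-reflexive (sym (double⁻ (+ m))))
  ≼N : ∀ p → Square p → p ≼ʸ north
  ≼N = ≼north (ℤₚ.≤-reflexive (sym (double (+ m)))) (ℤₚ.≤-reflexive (ℤₚ.+-inverseʳ (+ m)))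

-- Separates extra points from the box: each violates one of its inequalities by exactly one.
absurd-≤ : ∀ {i j} → i ℤ.≤ j → j ℤ.- i ≢ -1ℤ
absurd-≤ i≤j eq with subst (0ℤ ℤ.≤_) eq (↑ i≤j)
... | ()

unique-⊎ : ∀ {P Q : Pt → Set} → Unique P → Unique Q → (∀ p → P p → Q p → ⊥) → Unique (λ p → P p ⊎ Q p)
unique-⊎ uP uQ disjoint p (inj₁ a) (inj₁ b) = cong inj₁ (uP p a b)
unique-⊎ uP uQ disjoint p (inj₁ a) (inj₂ b) = ⊥-elim (disjoint p a b)
unique-⊎ uP uQ disjoint p (inj₂ a) (inj₁ b) = ⊥-elim (disjoint p b a)
unique-⊎ uP uQ disjoint p (inj₂ a) (inj₂ b) = cong inj₂ (uQ p a b)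

unique-point : ∀ q → Unique (_≡ q)
unique-point q p refl refl = refl

≼ˣ-refl : ∀ {p} → p ≼ˣ p
≼ˣ-refl = ℤₚ.≤-refl , ℤₚ.≤-refl

≼ʸ-refl : ∀ {p} → p ≼ʸ p
≼ʸ-refl = ℤₚ.≤-refl , ℤₚ.≤-refl

i≤i+1 : ∀ i → i ℤ.≤ i ℤ.+ 1ℤ
i≤i+1 i = linear (slack 1) (solve (i ∷ []))

-- The family `H2`: two extra corners.

module _ (m : ℕ) where
  private
    M = + m
    L = + (2 * m)

  -- The south and north vertices of the box are grid points, but (0,-1) and (2m+1,2m) in
  -- coordinates (s,t) have the wrong parity. The extra points replace them as west and east, so
  -- this diagonal is one longer than the other.
  H2-shape : Shape (H2 m) Opposite (suc (2 * m + 1)) (2 * m + 1) (suc m)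
  H2-shape = record
    { corner    = K
    ; corner∈   = λ { 0F → inj₂ (inj₁ refl) ; 1F → inj₂ (inj₂ refl) ; 2F → inj₁ S∈ ; 3F → inj₁ N∈ }
    ; WE        = WE
    ; SN        = ρ-y≡ (S≼ north N∈) (height M)
    ; WS        = ρ-x≡ (W≼ south S∈) (ℤₚ.+-comm M 1ℤ)
    ; WN        = ρ-x≡ (W≼ north N∈) (ℤₚ.+-comm M 1ℤ)
    ; ES        = trans (ρ-sym east south) (ρ-x≡ (≼E south S∈) (half M))
    ; EN        = trans (ρ-sym east north) (ρ-x≡ (≼E north N∈) (half M))
    ; spanned   = spanned
    ; isometric = λ (p , p∈) (q , q∈) → joined p q p∈ q∈ p∈ q∈
    }
    where
    west east south north : Pt
    west  = -1ℤ , + 0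
    east  = + (2 * m + 1) , + 1
    south = + m , ℤ.- + m
    north = + m , + suc m
    open Spans Opposite (λ o → o) opposite-sym west east south north
    B : Pt → Set
    B = Box (+ 0) (+ (2 * m + 1)) -1ℤ (+ (2 * m))
    height : ∀ i → (1ℤ ℤ.+ i) ℤ.- ℤ.- i ≡ i ℤ.+ (i ℤ.+ 0ℤ) ℤ.+ 1ℤ
    height = solve-∀
    half : ∀ i → i ℤ.+ (i ℤ.+ 0ℤ) ℤ.+ 1ℤ ℤ.- i ≡ 1ℤ ℤ.+ i
    half = solve-∀
    s-north : ∀ i → i ℤ.+ (1ℤ ℤ.+ i) ≡ i ℤ.+ (i ℤ.+ 0ℤ) ℤ.+ 1ℤ
    s-north = solve-∀
    t-north : ∀ i → i ℤ.- (1ℤ ℤ.+ i) ≡ -1ℤ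
    t-north = solve-∀
    S∈ : B south
    S∈ = box-at south (ℤₚ.+-inverseʳ M) (double⁻ M) ℤₚ.≤-refl (+≤+ z≤n) -≤+ ℤₚ.≤-refl
    N∈ : B north
    N∈ = box-at north (s-north M) (t-north M) (+≤+ z≤n) ℤₚ.≤-refl ℤₚ.≤-refl -≤+
    O∈ : B O
    O∈ = box-at O refl refl ℤₚ.≤-refl (+≤+ z≤n) -≤+ (+≤+ z≤n)
    W≼ : ∀ p → B p → west ≼ˣ p
    W≼ = west≼ -≤+ ℤₚ.≤-refl
    ≼E : ∀ p → B p → p ≼ˣ east
    ≼E = ≼east (i≤i+1 (+ (2 * m + 1))) (ℤₚ.≤-reflexive (cancel-1 L))
    S≼ : ∀ p → B p → south ≼ʸ p
    S≼ = south≼ (ℤₚ.≤-reflexive (ℤₚ.+-inverseʳ M)) (ℤₚ.≤-reflexive (sym (double⁻ M)))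
    ≼N : ∀ p → B p → p ≼ʸ north
    ≼N = ≼north (ℤₚ.≤-reflexive (sym (s-north M))) (ℤₚ.≤-reflexive (t-north M))
    W≼E : west ≼ˣ east
    W≼E = ≼ˣ-trans (W≼ O O∈) (≼E O O∈)
    WE : ρ west east ≡ suc (2 * m + 1)
    WE = ρ-x≡ W≼E (ℤₚ.+-comm (+ (2 * m + 1)) 1ℤ)
    W≼all : ∀ p → H2 m p → west ≼ˣ p
    W≼all p (inj₁ p∈)          = W≼ p p∈
    W≼all p (inj₂ (inj₁ refl)) = ≼ˣ-refl
    W≼all p (inj₂ (inj₂ refl)) = W≼E
    all≼E : ∀ p → H2 m p → p ≼ˣ east
    all≼E p (inj₁ p∈)          = ≼E p p∈
    all≼E p (inj₂ (inj₁ refl)) = W≼E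
    all≼E p (inj₂ (inj₂ refl)) = ≼ˣ-refl
    spanned : ∀ p q → H2 m p → H2 m q → Span p q
    spanned p q (inj₁ p∈)          (inj₁ q∈)          = span-box W≼ ≼E S≼ ≼N p∈ q∈
    spanned p q (inj₂ (inj₁ refl)) q∈                 = spanˣ ≼ˣ-refl (W≼all q q∈) (all≼E q q∈)
    spanned p q (inj₂ (inj₂ refl)) q∈                 = span-sym q p (spanˣ (W≼all q q∈) (all≼E q q∈) ≼ˣ-refl)
    spanned p q p∈                 (inj₂ (inj₁ refl)) = span-sym q p (spanˣ ≼ˣ-refl (W≼all p p∈) (all≼E p p∈))
    spanned p q p∈                 (inj₂ (inj₂ refl)) = spanˣ (W≼all p p∈) (all≼E p p∈) ≼ˣ-refl
    unique : Unique (H2 m)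
    unique = unique-⊎ Box-unique (unique-⊎ (unique-point _) (unique-point _) λ { p refl () })
      λ { p (() , _) (inj₁ refl) ; p (_ , e , _) (inj₂ refl) → absurd-≤ e (overshoot (+ (2 * m + 1))) }
    open Attach unique (λ _ → inj₁) Box-isometric
    1≤hs : 1ℤ ℤ.≤ + (2 * m + 1)
    1≤hs = +≤+ (ℕₚ.m≤n+m 1 (2 * m))
    gate-west : Gate B west
    gate-west = gate-ls west refl refl 1≤hs (+≤+ z≤n)
    gate-east : Gate B east
    gate-east = gate-hs′ east (cancel-1 (+ (2 * m + 1))) (cancel-1 L) 1≤hs (+≤+ z≤n)
    joined-WE : Joined west east
    joined-WE = joined-corners O gate-east O∈ refl
      (trans WE (cong suc (sym (ρ-x≡ (≼E O O∈) (ℤₚ.+-identityʳ (+ (2 * m + 1)))))))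
    joined : ∀ p q → H2 m p → H2 m q → Joined p q
    joined p q (inj₁ p∈)          (inj₁ q∈)          = joined-box p∈ q∈
    joined p q (inj₁ p∈)          (inj₂ (inj₁ refl)) = joined-sym (joined-gate gate-west p∈)
    joined p q (inj₁ p∈)          (inj₂ (inj₂ refl)) = joined-sym (joined-gate gate-east p∈)
    joined p q (inj₂ (inj₁ refl)) (inj₁ q∈)          = joined-gate gate-west q∈
    joined p q (inj₂ (inj₁ refl)) (inj₂ (inj₁ refl)) = joined-refl p
    joined p q (inj₂ (inj₁ refl)) (inj₂ (inj₂ refl)) = joined-WE
    joined p q (inj₂ (inj₂ refl)) (inj₁ q∈)          = joined-gate gate-east q∈
    joined p q (inj₂ (inj₂ refl)) (inj₂ (inj₁ refl)) = joined-sym joined-WE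
    joined p q (inj₂ (inj₂ refl)) (inj₂ (inj₂ refl)) = joined-refl p

-- The family `H3`: four extra corners.

module _ (m : ℕ) where
  private
    M = + m
    L = + (2 * m)

  -- All four vertices of the box have the wrong parity. Going between opposite corners through a
  -- third takes 2m+4 steps, one more than the diagonal; adjacent corners are thus spanned only by
  -- themselves, and `T` has to include them.
  H3-shape : Shape (H3 m) _≢_ (suc (2 * m + 2)) (suc (2 * m + 2)) (suc (suc m))
  H3-shape = record
    { corner    = K
    ; corner∈   = λ { 0F → inj₂ (inj₂ (inj₁ refl)) ; 1F → inj₂ (inj₂ (inj₂ (inj₂ refl)))
                    ; 2F → inj₂ (inj₁ refl) ; 3F → inj₂ (inj₂ (inj₂ (inj₁ refl))) }
    ; WE        = WE
    ; SN        = SN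
    ; WS        = WS
    ; WN        = WN
    ; ES        = ES
    ; EN        = EN
    ; spanned   = λ p q p∈ q∈ → spanned p q (view p p∈) (view q q∈)
    ; isometric = λ (p , p∈) (q , q∈) → joined p q (view p p∈) (view q q∈) p∈ q∈
    }
    where
    west east south north : Pt
    west  = -1ℤ , + 1
    east  = + (2 * m + 2) , + 0
    south = + m , -[1+ m ]
    north = + (m + 1) , + (m + 2)
    opposite⇒≢ : ∀ {i j} → Opposite i j → i ≢ j
    opposite⇒≢ we ()
    opposite⇒≢ ew ()
    opposite⇒≢ sn ()
    opposite⇒≢ ns ()
    open Spans _≢_ opposite⇒≢ (λ i≢j j≡i → i≢j (sym j≡i)) west east south north
    B : Pt → Set
    B = Box (+ 0) (+ (2 * m + 2)) -1ℤ (+ (2 * m + 1))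

    s-south : ∀ i → i ℤ.- (1ℤ ℤ.+ i) ≡ -1ℤ
    s-south = solve-∀
    t-south : ∀ i → i ℤ.- ℤ.- (1ℤ ℤ.+ i) ≡ i ℤ.+ (i ℤ.+ 0ℤ) ℤ.+ 1ℤ
    t-south = solve-∀
    s-north : ∀ i → i ℤ.+ 1ℤ ℤ.+ (i ℤ.+ + 2) ≡ i ℤ.+ (i ℤ.+ 0ℤ) ℤ.+ + 2 ℤ.+ 1ℤ
    s-north = solve-∀
    t-north : ∀ i → i ℤ.+ 1ℤ ℤ.- (i ℤ.+ + 2) ≡ -1ℤ
    t-north = solve-∀
    t-east : ∀ i → i ℤ.+ + 2 ℤ.- 0ℤ ≡ i ℤ.+ 1ℤ ℤ.+ 1ℤ
    t-east = solve-∀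
    height : ∀ i → (i ℤ.+ + 2) ℤ.- ℤ.- (1ℤ ℤ.+ i) ≡ 1ℤ ℤ.+ (i ℤ.+ (i ℤ.+ 0ℤ) ℤ.+ + 2)
    height = solve-∀
    side : ∀ i → i ℤ.+ 1ℤ ℤ.+ 1ℤ ≡ + 2 ℤ.+ i
    side = solve-∀
    half : ∀ i → i ℤ.+ (i ℤ.+ 0ℤ) ℤ.+ + 2 ℤ.- i ≡ + 2 ℤ.+ i
    half = solve-∀
    side′ : ∀ i → i ℤ.+ + 2 ℤ.- 0ℤ ≡ + 2 ℤ.+ i
    side′ = solve-∀

    W≼ : ∀ p → B p → west ≼ˣ p
    W≼ = west≼ ℤₚ.≤-refl (-≤- z≤n)
    ≼E : ∀ p → B p → p ≼ˣ east
    ≼E = ≼east (ℤₚ.≤-reflexive (sym (ℤₚ.+-identityʳ _)))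
               (ℤₚ.≤-trans (i≤i+1 (+ (2 * m + 1))) (ℤₚ.≤-reflexive (sym (t-east L))))
    S≼ : ∀ p → B p → south ≼ʸ p
    S≼ = south≼ (ℤₚ.≤-trans (ℤₚ.≤-reflexive (s-south M)) -≤+) (ℤₚ.≤-reflexive (sym (t-south M)))
    ≼N : ∀ p → B p → p ≼ʸ north
    ≼N = ≼north (ℤₚ.≤-trans (i≤i+1 (+ (2 * m + 2))) (ℤₚ.≤-reflexive (sym (s-north M)))) (ℤₚ.≤-reflexive (t-north M))

    -- First steps into the box on geodesics between extra points. The last three are written as
    -- sums to match `King-shift`.
    W₁ W₂ E₁ E₂ S₁ : Pt
    W₁ = + 0 , + 0
    W₂ = + 0 , + 1
    E₁ = + (2 * m + 2) ℤ.+ -1ℤ , + 0 ℤ.+ + 0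
    E₂ = + (2 * m + 2) ℤ.+ -1ℤ , + 0 ℤ.+ + 1
    S₁ = + m ℤ.+ + 0 , -[1+ m ] ℤ.+ + 1
    W₁∈ : B W₁
    W₁∈ = box-at W₁ refl refl ℤₚ.≤-refl (+≤+ z≤n) -≤+ (+≤+ z≤n)
    W₂∈ : B W₂
    W₂∈ = box-at W₂ refl refl (+≤+ z≤n) (+≤+ (ℕₚ.≤-trans (s≤s z≤n) (ℕₚ.m≤n+m 2 (2 * m)))) ℤₚ.≤-refl -≤+
    2m+1≤2m+2 : + (2 * m + 1) ℤ.≤ + (2 * m + 2)
    2m+1≤2m+2 = +≤+ (ℕₚ.+-monoʳ-≤ (2 * m) (s≤s z≤n))
    E₁∈ : B E₁
    E₁∈ = box-at E₁ (s-E₁ L) (t-E₁ L) (+≤+ z≤n) 2m+1≤2m+2 -≤+ ℤₚ.≤-refl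
      where
      s-E₁ : ∀ i → i ℤ.+ + 2 ℤ.+ -1ℤ ℤ.+ 0ℤ ≡ i ℤ.+ 1ℤ
      s-E₁ = solve-∀
      t-E₁ : ∀ i → i ℤ.+ + 2 ℤ.+ -1ℤ ℤ.- 0ℤ ≡ i ℤ.+ 1ℤ
      t-E₁ = solve-∀
    E₂∈ : B E₂
    E₂∈ = box-at E₂ (s-E₂ L) (t-E₂ L) (+≤+ z≤n) ℤₚ.≤-refl -≤+ (+≤+ (ℕₚ.m≤m+n (2 * m) 1))
      where
      s-E₂ : ∀ i → i ℤ.+ + 2 ℤ.+ -1ℤ ℤ.+ 1ℤ ≡ i ℤ.+ + 2
      s-E₂ = solve-∀
      t-E₂ : ∀ i → i ℤ.+ + 2 ℤ.+ -1ℤ ℤ.- 1ℤ ≡ i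
      t-E₂ = solve-∀
    S₁∈ : B S₁
    S₁∈ = box-at S₁ (s-S₁ M) (t-S₁ M) ℤₚ.≤-refl (+≤+ z≤n) -≤+ (+≤+ (ℕₚ.m≤m+n (2 * m) 1))
      where
      s-S₁ : ∀ i → i ℤ.+ 0ℤ ℤ.+ (ℤ.- (1ℤ ℤ.+ i) ℤ.+ 1ℤ) ≡ 0ℤ
      s-S₁ = solve-∀
      t-S₁ : ∀ i → i ℤ.+ 0ℤ ℤ.- (ℤ.- (1ℤ ℤ.+ i) ℤ.+ 1ℤ) ≡ i ℤ.+ (i ℤ.+ 0ℤ)
      t-S₁ = solve-∀

    W≼E : west ≼ˣ east
    W≼E = ≼ˣ-trans (W≼ W₁ W₁∈) (≼E W₁ W₁∈)
    S≼N : south ≼ʸ north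
    S≼N = ≼ʸ-trans (S≼ W₁ W₁∈) (≼N W₁ W₁∈)
    S≼W : south ≼ʸ west
    S≼W = ℤₚ.≤-trans (ℤₚ.≤-reflexive (s-south M)) -≤+ , ℤₚ.≤-trans -≤+ (ℤₚ.≤-reflexive (sym (t-south M)))
    W≼N : west ≼ˣ north
    W≼N = +≤+ z≤n , ℤₚ.≤-trans (-≤- z≤n) (ℤₚ.≤-reflexive (sym (t-north M)))
    S≼E : south ≼ˣ east
    S≼E = ℤₚ.≤-trans (ℤₚ.≤-reflexive (s-south M)) -≤+ ,
          ℤₚ.≤-trans (ℤₚ.≤-reflexive (t-south M))
            (ℤₚ.≤-trans (i≤i+1 (+ (2 * m + 1))) (ℤₚ.≤-reflexive (sym (t-east L))))
    E≼N : east ≼ʸ north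
    E≼N = ℤₚ.≤-trans (ℤₚ.≤-reflexive (ℤₚ.+-identityʳ _))
            (ℤₚ.≤-trans (i≤i+1 (+ (2 * m + 2))) (ℤₚ.≤-reflexive (sym (s-north M)))) ,
          ℤₚ.≤-trans (ℤₚ.≤-reflexive (t-north M)) -≤+

    WE : ρ west east ≡ suc (2 * m + 2)
    WE = ρ-x≡ W≼E (ℤₚ.+-comm (+ (2 * m + 2)) 1ℤ)
    SN : ρ south north ≡ suc (2 * m + 2)
    SN = ρ-y≡ S≼N (height M)
    WS : ρ west south ≡ suc (suc m)
    WS = trans (ρ-sym west south) (ρ-y≡ S≼W refl)
    WN : ρ west north ≡ suc (suc m)
    WN = ρ-x≡ W≼N (side M)
    ES : ρ east south ≡ suc (suc m)
    ES = trans (ρ-sym east south) (ρ-x≡ S≼E (half M))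
    EN : ρ east north ≡ suc (suc m)
    EN = ρ-y≡ E≼N (side′ M)

    unique : Unique (H3 m)
    unique = unique-⊎ Box-unique
      (unique-⊎ (unique-point _)
        (unique-⊎ (unique-point _)
          (unique-⊎ (unique-point _) (unique-point _) north≢east)
          λ { p refl (inj₁ ()) ; p refl (inj₂ ()) })
        λ { p refl (inj₁ ()) ; p e (inj₂ (inj₁ e′)) → south≢ e e′ ; p e (inj₂ (inj₂ e′)) → south≢ e e′ })
      λ { p (a , _) (inj₁ refl) → absurd-≤ a (trans (ℤₚ.+-identityʳ _) (s-south M))
        ; p (_ , _ , -≤- () , _) (inj₂ (inj₁ refl))
        ; p (_ , b , _) (inj₂ (inj₂ (inj₁ refl))) →
            absurd-≤ b (trans (cong (λ i → + (2 * m + 2) ℤ.- i) (s-north M)) (overshoot (+ (2 * m + 2))))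
        ; p (_ , _ , _ , b) (inj₂ (inj₂ (inj₂ refl))) →
            absurd-≤ b (trans (cong (λ i → + (2 * m + 1) ℤ.- i) (t-east L)) (overshoot (+ (2 * m + 1)))) }
      where
      south≢ : ∀ {p x n} → p ≡ south → p ≢ (x , + n)
      south≢ e e′ with cong proj₂ (trans (sym e) e′)
      ... | ()
      north≢east : ∀ p → p ≡ north → p ≢ east
      north≢east p e e′ = ℕₚ.m+1+n≢0 m (ℤₚ.+-injective (cong proj₂ (trans (sym e) e′)))

    -- Indexing the extra points by `Fin 4` lets the four corners be handled uniformly.
    data View (p : Pt) : Set where
      box    : B p → View p
      corner : ∀ i → p ≡ K i → View p

    view : ∀ p → H3 m p → View p
    view p (inj₁ p∈)                      = box p∈
    view p (inj₂ (inj₁ e))                = corner 2F e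
    view p (inj₂ (inj₂ (inj₁ e)))         = corner 0F e
    view p (inj₂ (inj₂ (inj₂ (inj₁ e))))  = corner 3F e
    view p (inj₂ (inj₂ (inj₂ (inj₂ e))))  = corner 1F e

    span-corner : ∀ i {q} → B q → Span (K i) q
    span-corner 0F {q} q∈ = spanˣ ≼ˣ-refl (W≼ q q∈) (≼E q q∈)
    span-corner 1F {q} q∈ = span-sym q east (spanˣ (W≼ q q∈) (≼E q q∈) ≼ˣ-refl)
    span-corner 2F {q} q∈ = spanʸ ≼ʸ-refl (S≼ q q∈) (≼N q q∈)
    span-corner 3F {q} q∈ = span-sym q north (spanʸ (S≼ q q∈) (≼N q q∈) ≼ʸ-refl)

    span-self : ∀ i → Span (K i) (K i)
    span-self 0F = spanˣ ≼ˣ-refl ≼ˣ-refl W≼E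
    span-self 1F = spanˣ W≼E ≼ˣ-refl ≼ˣ-refl
    span-self 2F = spanʸ ≼ʸ-refl ≼ʸ-refl S≼N
    span-self 3F = spanʸ S≼N ≼ʸ-refl ≼ʸ-refl

    spanned : ∀ p q → View p → View q → Span p q
    spanned p q (box p∈)        (box q∈)        = span-box W≼ ≼E S≼ ≼N p∈ q∈
    spanned p q (box p∈)        (corner j refl) = span-sym q p (span-corner j p∈)
    spanned p q (corner i refl) (box q∈)        = span-corner i q∈
    spanned p q (corner i refl) (corner j refl) with i ≟ j
    ... | yes refl = span-self i
    ... | no  i≢j  = span-corners i≢j

    open Attach unique (λ _ → inj₁) Box-isometric
    1≤hs : 1ℤ ℤ.≤ + (2 * m + 2)
    1≤hs = +≤+ (ℕₚ.≤-trans (s≤s z≤n) (ℕₚ.m≤n+m 2 (2 * m)))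
    gate-at : ∀ i → Gate B (K i)
    gate-at 0F = gate-lt west refl refl 1≤hs (+≤+ z≤n)
    gate-at 1F = gate-ht′ east (sym (ℤₚ.+-identityʳ _))
      (trans (cancel-1 (+ (2 * m + 1))) (cong (ℤ._- 1ℤ) (sym (t-east L)))) 1≤hs (+≤+ z≤n)
    gate-at 2F = gate-ls′ south (sym (cong (ℤ._+ 1ℤ) (s-south M))) (sym (t-south M)) 1≤hs (+≤+ z≤n)
    gate-at 3F = gate-hs north (trans (cancel-1 (+ (2 * m + 2))) (cong (ℤ._- 1ℤ) (sym (s-north M))))
      (sym (t-north M)) 1≤hs (+≤+ z≤n)

    joined-WE : Joined west east
    joined-WE = joined-corners W₁ (gate-at 1F) W₁∈ refl
      (trans WE (cong suc (sym (ρ-x≡ (≼E W₁ W₁∈) (ℤₚ.+-identityʳ _)))))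
    joined-SN : Joined south north
    joined-SN = joined-corners S₁ (gate-at 3F) S₁∈ (King-shift south (+ 0) (+ 1) refl)
      (trans SN (cong suc (sym (ρ-y≡ (≼N S₁ S₁∈) (rise M)))))
      where
      rise : ∀ i → i ℤ.+ + 2 ℤ.- (ℤ.- (1ℤ ℤ.+ i) ℤ.+ 1ℤ) ≡ i ℤ.+ (i ℤ.+ 0ℤ) ℤ.+ + 2
      rise = solve-∀
    joined-WS : Joined west south
    joined-WS = joined-corners W₁ (gate-at 2F) W₁∈ refl
      (trans WS (cong suc (sym (trans (ρ-sym W₁ south) (ρ-y≡ (S≼ W₁ W₁∈) refl)))))
    joined-WN : Joined west north
    joined-WN = joined-corners W₂ (gate-at 3F) W₂∈ refl
      (trans WN (cong suc (sym (ρ-y≡ (≼N W₂ W₂∈) (rise M)))))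
      where
      rise : ∀ i → i ℤ.+ + 2 ℤ.- 1ℤ ≡ 1ℤ ℤ.+ i
      rise = solve-∀
    joined-ES : Joined east south
    joined-ES = joined-corners E₁ (gate-at 2F) E₁∈ (King-shift east -1ℤ (+ 0) refl)
      (trans ES (cong suc (sym (trans (ρ-sym E₁ south) (ρ-y≡ (S≼ E₁ E₁∈) refl)))))
    joined-EN : Joined east north
    joined-EN = joined-corners E₂ (gate-at 3F) E₂∈ (King-shift east -1ℤ (+ 1) refl)
      (trans EN (cong suc (sym (ρ-y≡ (≼N E₂ E₂∈) (rise M)))))
      where
      rise : ∀ i → i ℤ.+ + 2 ℤ.- 1ℤ ≡ 1ℤ ℤ.+ i
      rise = solve-∀

    joined-KK : ∀ i j → Joined (K i) (K j)
    joined-KK 0F 0F = joined-refl west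
    joined-KK 0F 1F = joined-WE
    joined-KK 0F 2F = joined-WS
    joined-KK 0F 3F = joined-WN
    joined-KK 1F 0F = joined-sym joined-WE
    joined-KK 1F 1F = joined-refl east
    joined-KK 1F 2F = joined-ES
    joined-KK 1F 3F = joined-EN
    joined-KK 2F 0F = joined-sym joined-WS
    joined-KK 2F 1F = joined-sym joined-ES
    joined-KK 2F 2F = joined-refl south
    joined-KK 2F 3F = joined-SN
    joined-KK 3F 0F = joined-sym joined-WN
    joined-KK 3F 1F = joined-sym joined-EN
    joined-KK 3F 2F = joined-sym joined-SN
    joined-KK 3F 3F = joined-refl north

    joined : ∀ p q → View p → View q → Joined p q
    joined p q (box p∈)        (box q∈)        = joined-box p∈ q∈
    joined p q (box p∈)        (corner j refl) = joined-sym (joined-gate (gate-at j) p∈)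
    joined p q (corner i refl) (box q∈)        = joined-gate (gate-at i) q∈
    joined p q (corner i refl) (corner j refl) = joined-KK i j

-- Solving for the corner weights.

record Weights (e f ws wn es en P Q R : ℕ) : Set where
  constructor weigh
  field
    {α β γ δ} : ℕ
    e≡  : e ≡ α + γ + P
    f≡  : f ≡ β + δ + Q
    ws≡ : ws ≡ α + β + R
    wn≡ : wn ≡ α + δ + R
    es≡ : es ≡ γ + β + R
    en≡ : en ≡ γ + δ + R

-- `εx` and `εy` are the amounts by which the diagonals `P` and `Q` fall short of `2R`. The excesses
-- in the triangle inequalities are `2β + εx`, `2δ + εx` and `2γ + εy`, so each weight is
-- nonnegative by `halve`.
weightsℤ : ∀ {e f ws wn es en N R εx εy P Q α} →
  N ≡ R ℤ.+ R ℤ.- (εx ℤ.+ εy) → P ≡ R ℤ.+ R ℤ.- εx → Q ≡ R ℤ.+ R ℤ.- εy →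
  f ≡ ws ℤ.+ wn ℤ.- (α ℤ.+ α ℤ.+ εy) → e ≡ wn ℤ.+ es ℤ.+ N ℤ.- f → en ≡ e ℤ.+ f ℤ.- (N ℤ.+ ws) →
  εx ℤ.≤ 1ℤ → εy ℤ.≤ 1ℤ → e ℤ.≤ ws ℤ.+ es → e ℤ.≤ wn ℤ.+ en → f ℤ.≤ es ℤ.+ en →
  Σ (ℤ × ℤ × ℤ) λ (β , γ , δ) → (0ℤ ℤ.≤ β × 0ℤ ℤ.≤ γ × 0ℤ ℤ.≤ δ) ×
    (e ≡ α ℤ.+ γ ℤ.+ P × f ≡ β ℤ.+ δ ℤ.+ Q × ws ≡ α ℤ.+ β ℤ.+ R ×
     wn ≡ α ℤ.+ δ ℤ.+ R × es ≡ γ ℤ.+ β ℤ.+ R × en ≡ γ ℤ.+ δ ℤ.+ R)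
weightsℤ {ws = ws} {wn} {es} {R = R} {εx} {εy} {α = α} refl refl refl refl refl refl hx hy h₁ h₂ h₃ =
  (ws ℤ.- R ℤ.- α , es ℤ.- ws ℤ.+ α , wn ℤ.- R ℤ.- α) ,
  (halve (ws ℤ.- R ℤ.- α) (linear (↑ h₁ ⊕ ↑ hx) (solve vars)) ,
   halve (es ℤ.- ws ℤ.+ α) (linear (↑ h₃ ⊕ ↑ hy) (solve vars)) ,
   halve (wn ℤ.- R ℤ.- α) (linear (↑ h₂ ⊕ ↑ hx) (solve vars))) ,
  (solve vars , solve vars , solve vars , solve vars , solve vars , solve vars)
  where
  vars : List ℤ
  vars = ws ∷ wn ∷ es ∷ R ∷ εx ∷ εy ∷ α ∷ []

+-minus : ∀ i j {k} → i + j ≡ k → + i ≡ + k ℤ.- + j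
+-minus i j refl = cancel (+ i) (+ j)
  where
  cancel : ∀ i j → i ≡ i ℤ.+ j ℤ.- j
  cancel = solve-∀

-- Hypotheses are additive to avoid truncated subtraction. The fourth triangle excess, `2α + εy`, is
-- given as data, since its parity decides the case.
weights : ∀ {e f ws wn es en N R εx εy P Q} α →
  N + (εx + εy) ≡ R + R → P + εx ≡ R + R → Q + εy ≡ R + R →
  f + (α + α + εy) ≡ ws + wn → e + f ≡ wn + es + N → en + (N + ws) ≡ e + f →
  εx ≤ 1 → εy ≤ 1 → e ≤ ws + es → e ≤ wn + en → f ≤ es + en → Weights e f ws wn es en P Q R
weights {e} {f} {ws} {wn} {es} {en} {N} {R} {εx} {εy} {P} {Q} α hN hP hQ hf he hen hx hy h₁ h₂ h₃
  with weightsℤ {+ e} {+ f} {+ ws} {+ wn} {+ es} {+ en} {+ N} {+ R} {+ εx} {+ εy} {+ P} {+ Q} {+ α}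
                (+-minus N _ hN) (+-minus P _ hP) (+-minus Q _ hQ)
                (+-minus f _ hf) (+-minus e _ he) (+-minus en _ hen)
                (+≤+ hx) (+≤+ hy) (+≤+ h₁) (+≤+ h₂) (+≤+ h₃)
... | (+ β , + γ , + δ) , _ , (e₁ , e₂ , e₃ , e₄ , e₅ , e₆) = weigh {α = α} {β} {γ} {δ}
  (ℤₚ.+-injective e₁) (ℤₚ.+-injective e₂) (ℤₚ.+-injective e₃)
  (ℤₚ.+-injective e₄) (ℤₚ.+-injective e₅) (ℤₚ.+-injective e₆)

-- Hyperbolicity as a maximum of gaps.

maxList-upper : ∀ xs {x} → x ∈ xs → x ≤ maxList xs
maxList-upper (x ∷ xs) (here refl) = ℕₚ.m≤m⊔n x (maxList xs)
maxList-upper (x ∷ xs) (there x∈)  = ℕₚ.≤-trans (maxList-upper xs x∈) (ℕₚ.m≤n⊔m x (maxList xs))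

maxList-least : ∀ xs {b} → (∀ {x} → x ∈ xs → x ≤ b) → maxList xs ≤ b
maxList-least []       h = z≤n
maxList-least (x ∷ xs) h = ℕₚ.⊔-lub (h (here refl)) (maxList-least xs (λ x∈ → h (there x∈)))

module _ (G : Graph) (d : V G → V G → ℕ) where
  private
    vs = allFin (Graph.n G)

  quad2≤hb2 : ∀ u v w x → quad2 G d u v w x ≤ hb2 G d
  quad2≤hb2 u v w x = maxList-upper _
    (∈-concatMap⁺ _ (lose (∈-allFin u) (∈-concatMap⁺ _ (lose (∈-allFin v)
      (∈-concatMap⁺ _ (lose (∈-allFin w) (∈-map⁺ (quad2 G d u v w) (∈-allFin x))))))))

  hb2≤ : ∀ {b} → (∀ u v w x → quad2 G d u v w x ≤ b) → hb2 G d ≤ b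
  hb2≤ h = maxList-least _ λ r∈ → let
      u , _ , r∈ = find (∈-concatMap⁻ (λ u → concatMap (λ v → concatMap (λ w →
                     map (λ x → quad2 G d u v w x) vs) vs) vs) {xs = vs} r∈)
      v , _ , r∈ = find (∈-concatMap⁻ (λ v → concatMap (λ w → map (λ x → quad2 G d u v w x) vs) vs) {xs = vs} r∈)
      w , _ , r∈ = find (∈-concatMap⁻ (λ w → map (λ x → quad2 G d u v w x) vs) {xs = vs} r∈)
      x , _ , eq = ∈-map⁻ (quad2 G d u v w) r∈
    in ℕₚ.≤-trans (ℕₚ.≤-reflexive eq) (h u v w x)

∸≤gap : ∀ a b → a ∸ b ≤ gap a b b
∸≤gap a b = ℕₚ.∸-mono (ℕₚ.≤-trans (ℕₚ.m≤m⊔n a b) (ℕₚ.m≤m⊔n (a ⊔ b) b))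
  (ℕₚ.⊔-lub (ℕₚ.m⊓n≤n a b) (ℕₚ.m⊓n≤n (a ⊔ b) b))

<∸⇒+< : ∀ {g m n} → g < m ∸ n → g < m × suc g + n ≤ m
<∸⇒+< {g} {m} {n} lt = ℕₚ.<-≤-trans lt (ℕₚ.m∸n≤m m n) ,
  ℕₚ.m≤o∸n⇒m+n≤o (suc g) (ℕₚ.<⇒≤ (ℕₚ.m∸n≢0⇒n<m λ eq → ℕₚ.n≮0 (subst (g <_) eq lt))) lt

Dominates : ℕ → ℕ → ℕ → ℕ → Set
Dominates n a b c = (n + b ≤ a) × (n + c ≤ a)

-- `mid3` is the median, hence at least each of the two sums other than the largest.
gap-dominates : ∀ {g} a b c → g < gap a b c →
  Dominates (suc g) a b c ⊎ Dominates (suc g) b a c ⊎ Dominates (suc g) c a b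
gap-dominates {g} a b c lt = by-order (ℕₚ.≤-total a b) (ℕₚ.≤-total (a ⊔ b) c)
  where
  above-mid : ∀ {x y} → y ≤ mid3 a b c → max3 a b c ≤ x → suc g + y ≤ x
  above-mid y≤ ≤x = ℕₚ.≤-trans (ℕₚ.+-monoʳ-≤ (suc g) y≤)
    (ℕₚ.≤-trans (proj₂ (<∸⇒+< {m = max3 a b c} {mid3 a b c} lt)) ≤x)
  ⊓≤mid : ∀ {y} → y ≤ a → y ≤ b → y ≤ mid3 a b c
  ⊓≤mid y≤a y≤b = ℕₚ.≤-trans (ℕₚ.⊓-glb y≤a y≤b) (ℕₚ.m≤m⊔n (a ⊓ b) _)
  ⊔⊓≤mid : ∀ {y} → y ≤ a ⊔ b → y ≤ c → y ≤ mid3 a b c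
  ⊔⊓≤mid y≤ y≤c = ℕₚ.≤-trans (ℕₚ.⊓-glb y≤ y≤c) (ℕₚ.m≤n⊔m (a ⊓ b) _)
  by-order : a ≤ b ⊎ b ≤ a → a ⊔ b ≤ c ⊎ c ≤ a ⊔ b →
    Dominates (suc g) a b c ⊎ Dominates (suc g) b a c ⊎ Dominates (suc g) c a b
  by-order _ (inj₁ ≤c) = inj₂ (inj₂ (below (ℕₚ.m≤m⊔n a b) , below (ℕₚ.m≤n⊔m a b)))
    where
    below : ∀ {y} → y ≤ a ⊔ b → suc g + y ≤ c
    below y≤ = above-mid (⊔⊓≤mid y≤ (ℕₚ.≤-trans y≤ ≤c)) (ℕₚ.⊔-lub ≤c ℕₚ.≤-refl)
  by-order (inj₁ a≤b) (inj₂ c≤) =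
    inj₂ (inj₁ (above-mid (⊓≤mid ℕₚ.≤-refl a≤b) max≤ , above-mid (⊔⊓≤mid c≤ ℕₚ.≤-refl) max≤))
    where
    max≤ = ℕₚ.⊔-lub (ℕₚ.⊔-lub a≤b ℕₚ.≤-refl) (ℕₚ.≤-trans c≤ (ℕₚ.⊔-lub a≤b ℕₚ.≤-refl))
  by-order (inj₂ b≤a) (inj₂ c≤) = inj₁ (above-mid (⊓≤mid b≤a ℕₚ.≤-refl) max≤ , above-mid (⊔⊓≤mid c≤ ℕₚ.≤-refl) max≤)
    where
    max≤ = ℕₚ.⊔-lub (ℕₚ.⊔-lub ℕₚ.≤-refl b≤a) (ℕₚ.≤-trans c≤ (ℕₚ.⊔-lub ℕₚ.≤-refl b≤a))

pairwise : ∀ {R : Fin 4 → Fin 4 → Set} → (∀ {i j} → R i j → R j i) → (∀ i → R i i) →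
           R 0F 1F → R 2F 3F → R 0F 2F → R 0F 3F → R 1F 2F → R 1F 3F → ∀ i j → R i j
pairwise R-sym R-refl r₀₁ r₂₃ r₀₂ r₀₃ r₁₂ r₁₃ = λ where
  0F 0F → R-refl 0F
  0F 1F → r₀₁
  0F 2F → r₀₂
  0F 3F → r₀₃
  1F 0F → R-sym r₀₁
  1F 1F → R-refl 1F
  1F 2F → r₁₂
  1F 3F → r₁₃
  2F 0F → R-sym r₀₂
  2F 1F → R-sym r₁₂
  2F 2F → R-refl 2F
  2F 3F → r₂₃
  3F 0F → R-sym r₀₃
  3F 1F → R-sym r₁₃
  3F 2F → R-sym r₂₃
  3F 3F → R-refl 3F

-- Exchanges the diagonals by the reflection taking west to south and east to north, so that `wn`
-- and `es` trade places.
rotate : ∀ {e f ws wn es en P Q R} → Weights e f ws wn es en P Q R → Weights f e ws es wn en Q P R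
rotate {R = R} (weigh {α} {β} {γ} {δ} e f ws wn es en) = weigh {α = β} {α} {δ} {γ} f e
  (trans ws (cong (_+ R) (ℕₚ.+-comm α β))) (trans es (cong (_+ R) (ℕₚ.+-comm γ β)))
  (trans wn (cong (_+ R) (ℕₚ.+-comm α δ))) (trans en (cong (_+ R) (ℕₚ.+-comm γ δ)))

-- The remainder stays an explicit summand, to be read as `εy`.
parity : ∀ n → ∃ λ a → n ≡ a + a + 0 ⊎ n ≡ a + a + 1
parity zero = 0 , inj₁ refl
parity (suc n) with parity n
... | a , inj₁ eq = a , inj₂ (trans (cong suc eq) (step-odd a))
  where
  step-odd : ∀ a → suc (a + a + 0) ≡ a + a + 1
  step-odd = ℕ-Solver.solve-∀
... | a , inj₂ eq = suc a , inj₁ (trans (cong suc eq) (step-even a))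
  where
  step-even : ∀ a → suc (a + a + 1) ≡ suc a + suc a + 0
  step-even = ℕ-Solver.solve-∀

excess : ∀ {m n} → m ≤ n → ∃ λ o → m + o ≡ n
excess le = ℕₚ.m≤n⇒∃[o]m+o≡n le

exactly : ∀ {l n o x : ℕ} → x ≡ o → l ≡ n + o → l ≡ n + x
exactly refl l≡n+o = l≡n+o

-- A contained family forces a large gap.

module Obstruction (G : Graph) (d : V G → V G → ℕ) (isDist : IsDistFun G d) where
  open ShortestPath G d isDist

  -- The images of the corners keep their distances, so their three sums are `px + py`, `r + r` and
  -- `r + r`.
  gap≤hb2 : ∀ {P T px py r} → Shape P T px py r → ContainsIso P G d → (px + py) ∸ (r + r) ≤ hb2 G d
  gap≤hb2 {P} {px = px} {py} {r} shape (f , _ , _ , distances) = begin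
    (px + py) ∸ (r + r)              ≤⟨ ∸≤gap (px + py) (r + r) ⟩
    gap (px + py) (r + r) (r + r)    ≡⟨ sym (cong₃ gap (cong₂ _+_ (at 0F 1F WE) (at 2F 3F SN))
                                             (cong₂ _+_ (at 0F 2F WS) (at 1F 3F EN))
                                             (cong₂ _+_ (at 0F 3F WN) (at 1F 2F ES))) ⟩
    quad2 G d (F 0F) (F 1F) (F 2F) (F 3F) ≤⟨ quad2≤hb2 G d (F 0F) (F 1F) (F 2F) (F 3F) ⟩
    hb2 G d ∎
    where
    open Shape shape
    open ℕₚ.≤-Reasoning
    F : Fin 4 → V G
    F i = f (corner i , corner∈ i)
    at : ∀ i j {l} → ρ (corner i) (corner j) ≡ l → d (F i) (F j) ≡ l
    at i j eq = trans (distances _ _ _ (isometric⇒IsDist isometric (corner i , corner∈ i) (corner j , corner∈ j))) eq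
    cong₃ : ∀ (g : ℕ → ℕ → ℕ → ℕ) {a a′ b b′ c c′} → a ≡ a′ → b ≡ b′ → c ≡ c′ → g a b c ≡ g a′ b′ c′
    cong₃ g refl refl refl = refl

-- A large gap forces one of the families.

module Construction (G : Graph) (d : V G → V G → ℕ) (isDist : IsDistFun G d) (helly : Helly G d) where
  open ShortestPath G d isDist
  open Embedding G d isDist helly

  module _ {P T px py r} (shape : Shape P T px py r) (c : Fin 4 → V G) (w : Fin 4 → ℕ) where
    open Shape shape

    D X : Fin 4 → Fin 4 → ℕ
    D i j = d (c i) (c j)
    X i j = w i + w j + ρ (corner i) (corner j)

    D-sym : ∀ i j → D i j ≡ D j i
    D-sym i j = d-sym (c i) (c j)

    X-sym : ∀ i j → X i j ≡ X j i
    X-sym i j = cong₂ _+_ (ℕₚ.+-comm (w i) (w j)) (ρ-sym (corner i) (corner j))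

    contains : (∀ i j → D i j ≤ X i j) → (∀ i j → T i j → X i j ≤ D i j) → ContainsIso P G d
    contains upper tight = embed corner c w upper
      (λ p q p∈ q∈ → let (i , j , tij , between) = spanned p q p∈ q∈ in i , j , tight i j tij , between)
      isometric

    D-refl≤ : ∀ i → D i i ≤ X i i
    D-refl≤ i = ℕₚ.≤-trans (ℕₚ.≤-reflexive (d-refl (c i))) z≤n

  -- Only the diagonals have to be tight, so the sides may be any upper bounds of the distances.
  contains-diagonals : ∀ {P px py r} → Shape P Opposite px py r → ∀ a b c e {ws wn es en} →
    Weights (d a c) (d b e) ws wn es en px py r →
    d a b ≤ ws → d a e ≤ wn → d c b ≤ es → d c e ≤ en → ContainsIso P G d
  contains-diagonals {P} {px} {py} {r} shape a b c e {ws} {wn} {es} {en}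
    (weigh {α} {β} {γ} {δ} e≡ f≡ ws≡ wn≡ es≡ en≡) ab ae cb ce = contains shape C w upper tight
    where
    open Shape shape
    C = quadrilateral a c b e
    w = quadrilateral α γ β δ
    upper : ∀ i j → D shape C w i j ≤ X shape C w i j
    upper = pairwise {λ i j → D shape C w i j ≤ X shape C w i j}
      (λ {i} {j} → subst₂ _≤_ (D-sym shape C w i j) (X-sym shape C w i j)) (D-refl≤ shape C w)
      (ℕₚ.≤-reflexive (exactly WE e≡)) (ℕₚ.≤-reflexive (exactly SN f≡))
      (ℕₚ.≤-trans ab (ℕₚ.≤-reflexive (exactly WS ws≡))) (ℕₚ.≤-trans ae (ℕₚ.≤-reflexive (exactly WN wn≡)))
      (ℕₚ.≤-trans cb (ℕₚ.≤-reflexive (exactly ES es≡))) (ℕₚ.≤-trans ce (ℕₚ.≤-reflexive (exactly EN en≡)))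
    tight : ∀ i j → Opposite i j → X shape C w i j ≤ D shape C w i j
    tight _ _ we = ℕₚ.≤-reflexive (sym (exactly WE e≡))
    tight _ _ sn = ℕₚ.≤-reflexive (sym (exactly SN f≡))
    tight i j ew = subst₂ _≤_ (X-sym shape C w 0F 1F) (D-sym shape C w 0F 1F) (tight 0F 1F we)
    tight i j ns = subst₂ _≤_ (X-sym shape C w 2F 3F) (D-sym shape C w 2F 3F) (tight 2F 3F sn)

  contains-exact : ∀ {P px py r} → Shape P _≢_ px py r → ∀ a b c e →
    Weights (d a c) (d b e) (d a b) (d a e) (d c b) (d c e) px py r → ContainsIso P G d
  contains-exact shape a b c e (weigh {α} {β} {γ} {δ} e≡ f≡ ws≡ wn≡ es≡ en≡) = contains shape C w upper
    (λ i j i≢j → ℕₚ.≤-reflexive (sym (exact i j i≢j)))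
    where
    open Shape shape
    C = quadrilateral a c b e
    w = quadrilateral α γ β δ
    exact : ∀ i j → i ≢ j → D shape C w i j ≡ X shape C w i j
    exact = pairwise {λ i j → i ≢ j → D shape C w i j ≡ X shape C w i j}
      (λ {i} {j} eq j≢i → trans (D-sym shape C w j i) (trans (eq (λ i≡j → j≢i (sym i≡j))) (X-sym shape C w i j)))
      (λ i i≢i → ⊥-elim (i≢i refl))
      (λ _ → exactly WE e≡) (λ _ → exactly SN f≡) (λ _ → exactly WS ws≡)
      (λ _ → exactly WN wn≡) (λ _ → exactly ES es≡) (λ _ → exactly EN en≡)
    upper : ∀ i j → D shape C w i j ≤ X shape C w i j
    upper i j with i ≟ j
    ... | yes refl = D-refl≤ shape C w i
    ... | no  i≢j  = ℕₚ.≤-reflexive (exact i j i≢j)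

  -- The sides of a quadruple, enlarged until the gap between the largest sum and the two others is exactly N.
  record Tightened (N : ℕ) (a b c e : V G) (ws wn es en : ℕ) : Set where
    constructor tightened
    field
      ab  : d a b ≤ ws
      ae  : d a e ≤ wn
      cb  : d c b ≤ es
      ce  : d c e ≤ en
      eq₁ : en + (N + ws) ≡ d a c + d b e
      eq₂ : d a c + d b e ≡ wn + es + N

  -- The slack of each smaller sum is put on its side at `a`.
  tighten : ∀ {N a b c e} → N + (d a b + d c e) ≤ d a c + d b e → N + (d a e + d c b) ≤ d a c + d b e →
            ∃₂ λ x y → Tightened N a b c e (d a b + x) (d a e + y) (d c b) (d c e)
  tighten {N} {a} {b} {c} {e} h₁ h₂ with excess h₁ | excess h₂
  ... | x , e₁ | y , e₂ = x , y , tightened (ℕₚ.m≤m+n _ x) (ℕₚ.m≤m+n _ y) ℕₚ.≤-refl ℕₚ.≤-refl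
    (trans (shuffle₁ N (d a b) (d c e) x) e₁) (trans (sym e₂) (shuffle₂ N (d a e) (d c b) y))
    where
    shuffle₁ : ∀ n u v x → v + (n + (u + x)) ≡ n + (u + v) + x
    shuffle₁ = ℕ-Solver.solve-∀
    shuffle₂ : ∀ n u v x → n + (u + v) + x ≡ u + x + v + n
    shuffle₂ = ℕ-Solver.solve-∀

  -- The triangle inequality through `a`; its excess `z` becomes `2α + εy`.
  side-excess : ∀ {N a b c e ws wn es en} → Tightened N a b c e ws wn es en → ∃ λ z → d b e + z ≡ ws + wn
  side-excess {a = a} {b} {e = e} T = excess (ℕₚ.≤-trans (d-triangle b a e)
    (ℕₚ.+-mono-≤ (d-flip a b (Tightened.ab T)) (Tightened.ae T)))

  tightened-weights : ∀ {N a b c e ws wn es en R εx εy P Q} → Tightened N a b c e ws wn es en → ∀ α →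
    d b e + (α + α + εy) ≡ ws + wn → N + (εx + εy) ≡ R + R → P + εx ≡ R + R → Q + εy ≡ R + R →
    εx ≤ 1 → εy ≤ 1 → Weights (d a c) (d b e) ws wn es en P Q R
  tightened-weights {N} {a} {b} {c} {e} (tightened ab ae cb ce eq₁ eq₂) α hf hN hP hQ hx hy =
    weights α hN hP hQ hf eq₂ eq₁ hx hy
      (ℕₚ.≤-trans (d-triangle a b c) (ℕₚ.+-mono-≤ ab (d-flip c b cb)))
      (ℕₚ.≤-trans (d-triangle a e c) (ℕₚ.+-mono-≤ ae (d-flip c e ce)))
      (ℕₚ.≤-trans (d-triangle b c e) (ℕₚ.+-mono-≤ (d-flip c b cb) ce))

  -- The parity of the excess decides which diagonal of H2 the pair a, c spans.
  H2-from-gap : ∀ k a b c e → 2 * k + 1 + (d a b + d c e) ≤ d a c + d b e →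
    2 * k + 1 + (d a e + d c b) ≤ d a c + d b e → ContainsIso (H2 k) G d
  H2-from-gap k a b c e h₁ h₂ with tighten h₁ h₂
  ... | x , y , T with side-excess T
  ... | z , eq with parity z
  -- Odd excess: `εx = 0` and `εy = 1`, so `a` and `c` take the long diagonal from west to east.
  ... | α , inj₂ refl = contains-diagonals (H2-shape k) a b c e
          (tightened-weights T α eq (odd k) (even k) (odd k) z≤n (s≤s z≤n)) ab ae cb ce
    where
    open Tightened T
    odd : ∀ k → 2 * k + 1 + (0 + 1) ≡ suc k + suc k
    odd = ℕ-Solver.solve-∀
    even : ∀ k → suc (2 * k + 1) + 0 ≡ suc k + suc k
    even = ℕ-Solver.solve-∀
  -- Even excess: `εx = 1` and `εy = 0`, so the long diagonal belongs to `b` and `e`, and the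
  -- weights are reflected.
  ... | α , inj₁ refl = contains-diagonals (H2-shape k) b a e c
          (rotate (tightened-weights T α eq (odd k) (odd k) (even k) (s≤s z≤n) z≤n))
          (d-flip a b ab) (d-flip c b cb)
          (d-flip a e ae) (d-flip c e ce)
    where
    open Tightened T
    odd : ∀ k → 2 * k + 1 + 1 ≡ suc k + suc k
    odd = ℕ-Solver.solve-∀
    even : ∀ k → suc (2 * k + 1) + 0 ≡ suc k + suc k
    even = ℕ-Solver.solve-∀

  -- Both diagonals of `H1` are twice its side, so both corrections vanish and the excess at `a` has
  -- to be even.
  H1-from-tightened : ∀ {k a b c e ws wn es en} → Tightened (2 * k + 2) a b c e ws wn es en → ∀ α →
    d b e + (α + α + 0) ≡ ws + wn → ContainsIso (H1 (suc k)) G d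
  H1-from-tightened {k} {a} {b} {c} {e} T α eq = contains-diagonals (H1-shape (suc k)) a b c e
    (tightened-weights T α eq (even k) (even′ k) (even′ k) z≤n z≤n) ab ae cb ce
    where
    open Tightened T
    even : ∀ k → 2 * k + 2 + (0 + 0) ≡ suc k + suc k
    even = ℕ-Solver.solve-∀
    even′ : ∀ k → 2 * suc k + 0 ≡ suc k + suc k
    even′ = ℕ-Solver.solve-∀

  -- If the excess is odd, one unit of slack, where there is any, can be moved to the opposite side.
  H1⊎H3-from-gap : ∀ k a b c e → 2 * k + 2 + (d a b + d c e) ≤ d a c + d b e →
    2 * k + 2 + (d a e + d c b) ≤ d a c + d b e → ContainsIso (H1 (suc k)) G d ⊎ ContainsIso (H3 k) G d
  H1⊎H3-from-gap k a b c e h₁ h₂ with tighten h₁ h₂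
  ... | x , y , T with side-excess T
  ... | z , eq with parity z
  ... | α , inj₁ refl = inj₁ (H1-from-tightened T α eq)
  H1⊎H3-from-gap k a b c e h₁ h₂ | suc x , y , tightened ab ae cb ce eq₁ eq₂ | z , eq | α , inj₂ refl =
    -- The unit taken from the side `ab` goes to `ce`: their sum is unchanged, while the excess at
    -- `a` drops by one and becomes even.
    inj₁ (H1-from-tightened (tightened (ℕₚ.m≤m+n (d a b) x) ae cb (ℕₚ.n≤1+n (d c e))
      (trans (move (d a b) (d c e) (2 * k + 2) x) eq₁) eq₂) α
      (ℕₚ.suc-injective (trans (drop (d b e) α) (trans eq (cong (_+ (d a e + y)) (ℕₚ.+-suc (d a b) x))))))
    where
    move : ∀ u v n x → suc v + (n + (u + x)) ≡ v + (n + (u + suc x))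
    move = ℕ-Solver.solve-∀
    drop : ∀ f α → suc (f + (α + α + 0)) ≡ f + (α + α + 1)
    drop = ℕ-Solver.solve-∀
  H1⊎H3-from-gap k a b c e h₁ h₂ | zero , suc y , tightened ab ae cb ce eq₁ eq₂ | z , eq | α , inj₂ refl =
    inj₁ (H1-from-tightened (tightened ab (ℕₚ.m≤m+n (d a e) y) (ℕₚ.n≤1+n (d c b)) ce eq₁
      (trans eq₂ (move (d a e) (d c b) (2 * k + 2) y))) α
      (ℕₚ.suc-injective (trans (drop (d b e) α) (trans eq (lift (d a b) (d a e) y)))))
    where
    move : ∀ u v n x → u + suc x + v + n ≡ u + x + suc v + n
    move = ℕ-Solver.solve-∀
    drop : ∀ f α → suc (f + (α + α + 0)) ≡ f + (α + α + 1)
    drop = ℕ-Solver.solve-∀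
    lift : ∀ u v x → u + 0 + (v + suc x) ≡ suc (u + 0 + (v + x))
    lift = ℕ-Solver.solve-∀
  -- Without slack the sides are the true distances, as tightness of all six pairs in `H3` demands;
  -- here `εx = εy = 1`.
  H1⊎H3-from-gap k a b c e h₁ h₂ | zero , zero , T | z , eq | α , inj₂ refl =
    inj₂ (contains-exact (H3-shape k) a b c e
      (subst₂ (λ ws wn → Weights (d a c) (d b e) ws wn (d c b) (d c e) _ _ _)
        (ℕₚ.+-identityʳ (d a b)) (ℕₚ.+-identityʳ (d a e))
        (tightened-weights T α eq (even k) (odd k) (odd k) (s≤s z≤n) (s≤s z≤n))))
    where
    even : ∀ k → 2 * k + 2 + (1 + 1) ≡ suc (suc k) + suc (suc k)
    even = ℕ-Solver.solve-∀
    odd : ∀ k → suc (2 * k + 2) + 1 ≡ suc (suc k) + suc (suc k)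
    odd = ℕ-Solver.solve-∀

  -- Relabels the quadruple so that the largest sum is the one of the diagonals `ac` and `be`.
  from-gap : ∀ {C : Set} N → (∀ a b c e → suc N + (d a b + d c e) ≤ d a c + d b e →
    suc N + (d a e + d c b) ≤ d a c + d b e → C) → ∀ u v w x → N < quad2 G d u v w x → C
  from-gap N construct u v w x lt with gap-dominates (d u v + d w x) (d u w + d v x) (d u x + d v w) lt
  ... | inj₁ (h₁ , h₂) = construct u w v x h₁ h₂
  ... | inj₂ (inj₁ (h₁ , h₂)) = construct u v w x h₁
        (subst (λ l → suc N + (d u x + l) ≤ d u w + d v x) (d-sym v w) h₂)
  ... | inj₂ (inj₂ (h₁ , h₂)) = construct u v x w
        (subst (λ l → suc N + (d u v + l) ≤ d u x + d v w) (d-sym w x) h₁)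
        (subst (λ l → suc N + (d u w + l) ≤ d u x + d v w) (d-sym v x) h₂)

-- The two equivalences.

theorem3 : (G : Graph) → Connected G → (d : V G → V G → ℕ) → IsDistFun G d → Helly G d →
    (k : ℕ) →
    ((hb2 G d ≤ 2 * k) ⇔ (¬ ContainsIso (H2 k) G d))
    × ((hb2 G d ≤ 2 * k + 1) ⇔ ((¬ ContainsIso (H1 (suc k)) G d) × (¬ ContainsIso (H3 k) G d)))
theorem3 G _ d isDist helly k =
  mk⇔ (λ hb≤ H2⊂G → exceeds (sum₂ k) (gap≤hb2 (H2-shape k) H2⊂G) hb≤)
      (λ no-H2 → bounded λ u v w x lt → no-H2 (from-gap (2 * k) (λ a b c e h₁ h₂ →
         H2-from-gap k a b c e (weaken₁ h₁) (weaken₁ h₂)) u v w x lt)) ,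
  mk⇔ (λ hb≤ → (λ H1⊂G → exceeds (sum₁ k) (gap≤hb2 (H1-shape (suc k)) H1⊂G) hb≤) ,
               (λ H3⊂G → exceeds (sum₃ k) (gap≤hb2 (H3-shape k) H3⊂G) hb≤))
      (λ (no-H1 , no-H3) → bounded λ u v w x lt → [ no-H1 , no-H3 ]′ (from-gap (2 * k + 1) (λ a b c e h₁ h₂ →
         H1⊎H3-from-gap k a b c e (weaken₂ h₁) (weaken₂ h₂)) u v w x lt))
  where
  open Obstruction G d isDist
  open Construction G d isDist helly
  exceeds : ∀ {b l m} → l ≡ suc b + m → l ∸ m ≤ hb2 G d → ¬ (hb2 G d ≤ b)
  exceeds {b} {m = m} refl gap≤ hb≤ =
    ℕₚ.<⇒≱ (ℕₚ.≤-trans (ℕₚ.≤-reflexive (sym (ℕₚ.m+n∸n≡m (suc b) m))) gap≤) hb≤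
  bounded : ∀ {b} → (∀ u v w x → ¬ (b < quad2 G d u v w x)) → hb2 G d ≤ b
  bounded h = hb2≤ G d (λ u v w x → ℕₚ.≮⇒≥ (h u v w x))
  weaken₁ : ∀ {l m} → suc (2 * k) + l ≤ m → 2 * k + 1 + l ≤ m
  weaken₁ {l} {m} = subst (λ n → n + l ≤ m) (ℕₚ.+-comm 1 (2 * k))
  weaken₂ : ∀ {l m} → suc (2 * k + 1) + l ≤ m → 2 * k + 2 + l ≤ m
  weaken₂ {l} {m} = subst (λ n → n + l ≤ m) (sym (ℕₚ.+-suc (2 * k) 1))
  -- The corner gaps are `2k+2` for `H1` and `H3` and `2k+1` for `H2`, each one more than the bound
  -- on `hb2` that it refutes.
  sum₁ : ∀ k → 2 * suc k + 2 * suc k ≡ suc (2 * k + 1) + (suc k + suc k)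
  sum₁ = ℕ-Solver.solve-∀
  sum₂ : ∀ k → suc (2 * k + 1) + (2 * k + 1) ≡ suc (2 * k) + (suc k + suc k)
  sum₂ = ℕ-Solver.solve-∀
  sum₃ : ∀ k → suc (2 * k + 2) + suc (2 * k + 2) ≡ suc (2 * k + 1) + (suc (suc k) + suc (suc k))
  sum₃ = ℕ-Solver.solve-∀
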